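{- For $n\ge5$, the number $M(f_n)$ of maximal closed substrings (counted as occurrences, i.e., by position pairs $(i,j)$) in the Fibonacci word $f_n$ is $$M(f_n)=\begin{cases}F_n+F_{n-2}-1, & \text{if } n \text{ is odd},\\ F_n+F_{n-2}-2, & \text{if } n \text{ is even}.\end{cases}$$ Furthermore, $M(f_n)\approx\left(1+\frac{1}{\phi^2}\right)F_n\approx 1.382\,F_n$, in the sense that $M(f_n)<F_n+F_{n-2}$ and $M(f_n)/F_n\to 1+1/\phi^2$ as $n\to\infty$, where $\phi=\frac{1+\sqrt5}{2}$.
   Context: Fibonacci words are defined by $f_0=0$, $f_1=1$, $f_n=f_{n-1}f_{n-2}$ for $n\ge2$, and $F_n=|f_n|$ (so $F_0=F_1=1$, $F_n=F_{n-1}+F_{n-2}$). Strings are indexed from 1; $w[i..j]$ denotes an occurrence. A border of a string $x$ is a nonempty string that is both a proper prefix and a proper suffix of $x$. A string $x$ is closed if $|x|=1$, or $|x|\ge2$ and $x$ has a border occurring in $x$ only as a prefix and as a suffix and nowhere else. In a string $w[1..N]$, an occurrence $w[i..j]$ is maximal right-closed if it is closed and either $j=N$ or $w[i..j+1]$ is not closed; maximal left-closed if it is closed and either $i=1$ or $w[i-1..j]$ is not closed; and a maximal closed substring (MCS) if it is both maximal left-closed and maximal right-closed. -}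

module Defs where

open import Data.Nat using (ℕ; zero; suc; _+_; _*_; _∸_; _≤_; _<_)
open import Data.Bool using (Bool; true; false)
open import Data.List using (List; []; _∷_; _++_; length; take; drop)
open import Data.Product using (Σ; ∃; _×_; _,_)
open import Data.Sum using (_⊎_)
open import Relation.Binary.PropositionalEquality using (_≡_; _≢_)
open import Relation.Nullary using (¬_)

-- Letters: false = 0, true = 1
Word : Set
Word = List Bool

fibWord : ℕ → Word
fibWord zero = false ∷ []
fibWord (suc zero) = true ∷ []
fibWord (suc (suc n)) = fibWord (suc n) ++ fibWord n

-- F_n = |f_n| : F_0 = F_1 = 1
F : ℕ → ℕ
F zero = 1
F (suc zero) = 1
F (suc (suc n)) = F (suc n) + F n

IsPrefix : Word → Word → Set
IsPrefix u x = ∃ λ v → u ++ v ≡ x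

IsSuffix : Word → Word → Set
IsSuffix u x = ∃ λ v → v ++ u ≡ x

IsBorder : Word → Word → Set
IsBorder u x = (u ≢ []) × (length u < length x) × IsPrefix u x × IsSuffix u x

OccursAt : Word → Word → ℕ → Set
OccursAt u x k = IsPrefix u (drop k x)

Closed : Word → Set
Closed x = (length x ≡ 1)
         ⊎ ((2 ≤ length x) × (∃ λ u → IsBorder u x ×
              (∀ k → OccursAt u x k → (k ≡ 0) ⊎ (k ≡ length x ∸ length u))))

-- w[i..j], 1-indexed, inclusive
sub : Word → ℕ → ℕ → Word
sub w i j = take (suc (j ∸ i)) (drop (i ∸ 1) w)

Occ : Word → ℕ → ℕ → Set
Occ w i j = (1 ≤ i) × (i ≤ j) × (j ≤ length w)

MaxRightClosed : Word → ℕ → ℕ → Set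
MaxRightClosed w i j = Occ w i j × Closed (sub w i j)
  × ((j ≡ length w) ⊎ ¬ Closed (sub w i (suc j)))

MaxLeftClosed : Word → ℕ → ℕ → Set
MaxLeftClosed w i j = Occ w i j × Closed (sub w i j)
  × ((i ≡ 1) ⊎ ¬ Closed (sub w (i ∸ 1) j))

MCS : Word → ℕ → ℕ → Set
MCS w i j = MaxLeftClosed w i j × MaxRightClosed w i j

{-# OPTIONS --safe #-}
module Submission where

-- Let φ be the morphism 1 ↦ 10, 0 ↦ 1 and put ψ w = φ w 1. In ψ w every letter 1
-- marks a cut point of w and no 0 is next to a 0, so a maximal closed substring of
-- ψ w of length at least 2 starts and ends with 1 and is ψ x for a unique maximal
-- closed substring x of w. Hence M(ψ w) = M(w) + (number of isolated letters of ψ w)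
-- for every word w. The words f_n are, up to one or two letters at the end, iterated
-- ψ-images, and removing such a letter destroys one or two maximal closed substrings:
-- the final letter, and the final 101 if it is maximal. Everything is
-- reversal-invariant, and we read Fibonacci words backwards so that letters are
-- removed at the front.
--
-- For the limit put S = 3 F_n − 2 F_{n−2}. Cassini's identity gives
-- S² = 5 F_n² ± 4, and 2 M(f_n) = 5 F_n − S − 2c with c ∈ {1, 2}.

open import Defs
open import Data.Bool using (Bool; true; false; not)
open import Data.Empty using (⊥)
open import Data.Nat using (ℕ; zero; suc; _+_; _*_; _∸_; _≤_; _<_; _%_; z≤n; s≤s; _≤?_; >-nonZero)
open import Data.Nat.DivMod using ([m+kn]%n≡m%n)
open import Data.Nat.Properties
open import Data.Nat.Tactic.RingSolver using (solve-∀)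
open import Data.Integer as ℤ using (ℤ; +_; -[1+_])
import Data.Integer.Properties as ℤ
import Data.Integer.Tactic.RingSolver as ℤ
open import Data.List using (List; []; _∷_; _++_; _∷ʳ_; [_]; length; reverse; map; take; drop; initLast; _∷ʳ′_)
open import Data.List.Properties
open import Data.List.Membership.Propositional using (_∈_)
open import Data.List.Membership.Propositional.Properties
  using (∈-map⁺; ∈-map⁻; ∈-++⁺ˡ; ∈-++⁺ʳ; ∈-++⁻)
open import Data.List.Relation.Unary.All as All using (All; []; _∷_)
import Data.List.Relation.Unary.All.Properties as All
open import Data.List.Relation.Unary.AllPairs using ([]; _∷_)
open import Data.List.Relation.Unary.Any using (here; there)
open import Data.List.Relation.Unary.Unique.Propositional using (Unique)
import Data.List.Relation.Unary.Unique.Propositional.Properties as Unique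
open import Data.Product using (Σ; ∃; ∃₂; _×_; _,_; proj₁; proj₂; uncurry)
open import Data.Sum using (_⊎_; inj₁; inj₂)
open import Function using (_∘_; _⇔_; mk⇔; Equivalence)
open import Relation.Binary.PropositionalEquality
  using (_≡_; _≢_; refl; sym; trans; cong; cong₂; subst; subst₂; module ≡-Reasoning)
open import Relation.Nullary using (¬_; contradiction; yes; no)
open Equivalence using (to; from)

-- A border passes through φ only if both its ends fall on cut points; the 1 appended by ψ supplies
-- the last one. The empty border of a single letter becomes the border 1 = `ψ []`, so the letters 0
-- and 1 turn into the closed words 11 and 101. Single letters of `ψ w` are never images of closed
-- words, which is why they enter the recursion as a separate term.
--
-- Backwards, f_(n+1) is `φ′` of f_n, that is, a ψ-image without its first 1. If f_(2k+1) is 1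
-- followed by `τ k`, two steps lead exactly to `ψ (ψ (τ k))`, so one letter is removed in every two
-- steps. From f_5 on, that letter starts a word 1010..., and only the letter itself disappears,
-- because 101 extends to the closed word 1010. For even n there is one more removal, from a word
-- 1011..., where 101 is maximal and disappears too: here the parity of n enters.

private variable
  A B : Set
  P Q : A → Set
  m n : ℕ
  l r u v w x y : Word

-- Closed words and the morphism φ

-- Factorizations replace positions here, so that the last clause is symmetric under reversal and
-- can be carried along ψ without arithmetic on indices.
CompleteReturn : Word → Word → Set
CompleteReturn u x = u ≢ []
  × (∃ λ b → b ≢ [] × u ++ b ≡ x)
  × (∃ λ a → a ≢ [] × a ++ u ≡ x)
  × (∀ a b → a ++ u ++ b ≡ x → a ≡ [] ⊎ b ≡ [])

data Closed′ : Word → Set where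
  single : ∀ c → Closed′ [ c ]
  return : CompleteReturn u x → Closed′ x

∷ʳ≢[] : ∀ (a : Word) {c} → a ∷ʳ c ≢ []
∷ʳ≢[] [] ()
∷ʳ≢[] (_ ∷ _) ()

reverse≢[] : x ≢ [] → reverse x ≢ []
reverse≢[] {x} x≢[] p = x≢[] (trans (sym (reverse-involutive x)) (cong reverse p))

reverse-≡[] : reverse x ≡ [] → x ≡ []
reverse-≡[] {x} p = trans (sym (reverse-involutive x)) (cong reverse p)

reverse-++₃ : ∀ (a b c : Word) → reverse (a ++ b ++ c) ≡ reverse c ++ reverse b ++ reverse a
reverse-++₃ a b c = begin
  reverse (a ++ b ++ c)                     ≡⟨ reverse-++ a (b ++ c) ⟩
  reverse (b ++ c) ++ reverse a             ≡⟨ cong (_++ reverse a) (reverse-++ b c) ⟩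
  (reverse c ++ reverse b) ++ reverse a     ≡⟨ ++-assoc (reverse c) _ _ ⟩
  reverse c ++ reverse b ++ reverse a       ∎
  where open ≡-Reasoning

CompleteReturn-reverse : CompleteReturn u x → CompleteReturn (reverse u) (reverse x)
CompleteReturn-reverse {u} {x} (u≢[] , (b , b≢[] , ub) , (a , a≢[] , au) , only) =
  reverse≢[] u≢[]
  , (reverse a , reverse≢[] a≢[] , trans (sym (reverse-++ a u)) (cong reverse au))
  , (reverse b , reverse≢[] b≢[] , trans (sym (reverse-++ u b)) (cong reverse ub))
  , only′
  where
  only′ : ∀ c d → c ++ reverse u ++ d ≡ reverse x → c ≡ [] ⊎ d ≡ []
  only′ c d p with only (reverse d) (reverse c) q
    where
    q : reverse d ++ u ++ reverse c ≡ x
    q = begin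
      reverse d ++ u ++ reverse c                     ≡⟨ cong (λ s → reverse d ++ s ++ reverse c) (reverse-involutive u) ⟨
      reverse d ++ reverse (reverse u) ++ reverse c   ≡⟨ reverse-++₃ c (reverse u) d ⟨
      reverse (c ++ reverse u ++ d)                   ≡⟨ cong reverse p ⟩
      reverse (reverse x)                             ≡⟨ reverse-involutive x ⟩
      x                                               ∎
      where open ≡-Reasoning
  ... | inj₁ e = inj₂ (reverse-≡[] e)
  ... | inj₂ e = inj₁ (reverse-≡[] e)

Closed′-reverse : Closed′ x → Closed′ (reverse x)
Closed′-reverse (single c) = single c
Closed′-reverse (return r) = return (CompleteReturn-reverse r)

Closed′-reverse⁻ : Closed′ (reverse x) → Closed′ x
Closed′-reverse⁻ {x} c = subst Closed′ (reverse-involutive x) (Closed′-reverse c)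

Closed′⇒≢[] : Closed′ x → x ≢ []
Closed′⇒≢[] (single c) ()
Closed′⇒≢[] (return (u≢[] , (b , _ , refl) , _)) p = u≢[] (++-conicalˡ _ b p)

closed-pair : ∀ {c d} → Closed′ (c ∷ d ∷ []) → c ≡ d
closed-pair (return {u = []} (u≢[] , _)) = contradiction refl u≢[]
closed-pair (return {u = _ ∷ []} (_ , (_ , _ , refl) , (_ ∷ [] , _ , refl) , _)) = refl
closed-pair (return {u = _ ∷ []} (_ , _ , ([] , a≢[] , _) , _)) = contradiction refl a≢[]
closed-pair (return {u = _ ∷ []} (_ , _ , (_ ∷ _ ∷ [] , _ , ()) , _))
closed-pair (return {u = _ ∷ []} (_ , _ , (_ ∷ _ ∷ _ ∷ _ , _ , ()) , _))
closed-pair (return {u = _ ∷ _ ∷ u} (_ , (b , b≢[] , p) , _)) =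
  contradiction (++-conicalʳ u b (∷-injectiveʳ (∷-injectiveʳ p))) b≢[]

pair-closed : ∀ c → Closed′ (c ∷ c ∷ [])
pair-closed c = return {u = [ c ]}
  ((λ ()) , ([ c ] , (λ ()) , refl) , ([ c ] , (λ ()) , refl) , only)
  where
  only : ∀ a b → a ++ [ c ] ++ b ≡ c ∷ c ∷ [] → a ≡ [] ⊎ b ≡ []
  only [] b p = inj₁ refl
  only (_ ∷ []) b p = inj₂ (∷-injectiveʳ (∷-injectiveʳ p))
  only (_ ∷ _ ∷ a) b p = contradiction (++-conicalʳ a _ (∷-injectiveʳ (∷-injectiveʳ p))) λ ()

-- Words without 00

No00 : Word → Set
No00 x = ∀ a b → a ++ false ∷ false ∷ b ≢ x

No00-factor : ∀ a b → No00 (a ++ x ++ b) → No00 x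
No00-factor a b nz c d refl = nz (a ++ c) (d ++ b) (begin
  (a ++ c) ++ false ∷ false ∷ d ++ b     ≡⟨ ++-assoc a c _ ⟩
  a ++ c ++ false ∷ false ∷ d ++ b       ≡⟨ cong (a ++_) (++-assoc c _ b) ⟨
  a ++ (c ++ false ∷ false ∷ d) ++ b     ∎)
  where open ≡-Reasoning

No00-reverse : No00 x → No00 (reverse x)
No00-reverse {x} nz a b p = nz (reverse b) (reverse a) (begin
  reverse b ++ false ∷ false ∷ reverse a                   ≡⟨ reverse-++₃ a (false ∷ false ∷ []) b ⟨
  reverse (a ++ false ∷ false ∷ b)                         ≡⟨ cong reverse p ⟩
  reverse (reverse x)                                      ≡⟨ reverse-involutive x ⟩
  x                                                        ∎)
  where open ≡-Reasoning

No00-tail : ∀ {c} → No00 (c ∷ x) → No00 x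
No00-tail nz a b p = nz (_ ∷ a) b (cong (_ ∷_) p)

one-before-zero : ∀ a → a ≢ [] → No00 (a ++ false ∷ u) → ∃ λ a′ → a ≡ a′ ∷ʳ true
one-before-zero a a≢[] nz with initLast a
... | [] = contradiction refl a≢[]
... | a′ ∷ʳ′ true = a′ , refl
... | a′ ∷ʳ′ false = contradiction (sym (++-assoc a′ _ _)) (nz a′ _)

-- A 0 which is not the first letter is preceded by 1, so prepending 1 to a
-- word starting with 0 also prepends 1 to each occurrence of its border.
closed-1∷ : y ≢ [] → No00 (false ∷ y) → Closed′ (false ∷ y) → Closed′ (true ∷ false ∷ y)
closed-1∷ y≢[] nz (single _) = contradiction refl y≢[]
closed-1∷ y≢[] nz (return {u = []} (u≢[] , _)) = contradiction refl u≢[]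
closed-1∷ y≢[] nz (return {u = true ∷ _} (_ , (_ , _ , ()) , _))
closed-1∷ {y} y≢[] nz (return {u = false ∷ u} (_ , (b , b≢[] , p) , (a , a≢[] , q) , only))
  with a′ , refl ← one-before-zero a a≢[] (subst No00 (sym q) nz) =
  return {u = true ∷ false ∷ u}
    ((λ ()) , (b , b≢[] , cong (true ∷_) p)
    , (true ∷ a′ , (λ ()) , cong (true ∷_) (trans (sym (++-assoc a′ _ _)) q))
    , only′)
  where
  only′ : ∀ c d → c ++ true ∷ false ∷ u ++ d ≡ true ∷ false ∷ y → c ≡ [] ⊎ d ≡ []
  only′ [] d e = inj₁ refl
  only′ (_ ∷ c) d e with only (c ∷ʳ true) d (trans (++-assoc c _ _) (∷-injectiveʳ e))
  ... | inj₁ c≡[] = contradiction c≡[] (∷ʳ≢[] c)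
  ... | inj₂ d≡[] = inj₂ d≡[]

-- With border 1, the 1 that must follow 10 is a second occurrence, hence the last letter, and the
-- word is 101, whose remainder 01 is not closed. A longer border starts with 10. Without its 1 it
-- starts with 0, and an inner occurrence of that shorter border is preceded by 1 again.
closed-1∷⁻ : y ≢ [] → y ≢ [ true ] → No00 (false ∷ y) →
             Closed′ (true ∷ false ∷ y) → Closed′ (false ∷ y)
closed-1∷⁻ y≢[] y≢1 nz (return {u = []} (u≢[] , _)) = contradiction refl u≢[]
closed-1∷⁻ y≢[] y≢1 nz (return {u = false ∷ _} (_ , (_ , _ , ()) , _))
closed-1∷⁻ {[]} y≢[] y≢1 nz (return {u = true ∷ []} _) = contradiction refl y≢[]
closed-1∷⁻ {false ∷ y} y≢[] y≢1 nz (return {u = true ∷ []} _) = contradiction refl (nz [] y)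
closed-1∷⁻ {true ∷ y} y≢[] y≢1 nz (return {u = true ∷ []} (_ , _ , _ , only))
  with inj₂ refl ← only (true ∷ false ∷ []) y refl = contradiction refl y≢1
closed-1∷⁻ y≢[] y≢1 nz (return {u = true ∷ true ∷ _} (_ , (_ , _ , ()) , _))
closed-1∷⁻ {y} y≢[] y≢1 nz (return {u = true ∷ false ∷ u} (_ , (b , b≢[] , p) , (a , a≢[] , q) , only)) =
  return {u = false ∷ u} ((λ ()) , (b , b≢[] , ∷-injectiveʳ p) , suffix a a≢[] q , only′)
  where
  suffix : ∀ a → a ≢ [] → a ++ true ∷ false ∷ u ≡ true ∷ false ∷ y →
           ∃ λ a′ → a′ ≢ [] × a′ ++ false ∷ u ≡ false ∷ y
  suffix [] a≢[] e = contradiction refl a≢[]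
  suffix (_ ∷ a) _ e = a ∷ʳ true , ∷ʳ≢[] a , trans (++-assoc a _ _) (∷-injectiveʳ e)
  only′ : ∀ c d → c ++ false ∷ u ++ d ≡ false ∷ y → c ≡ [] ⊎ d ≡ []
  only′ [] d e = inj₁ refl
  only′ c@(_ ∷ _) d e
    with c′ , c≡ ← one-before-zero c (λ ()) (subst No00 (sym e) nz)
    with only (true ∷ c′) d (cong (true ∷_) (trans (sym (++-assoc c′ _ _)) (subst (λ s → s ++ _ ≡ _) c≡ e)))
  ... | inj₂ d≡[] = inj₂ d≡[]

φ : Word → Word
φ [] = []
φ (true ∷ w) = true ∷ false ∷ φ w
φ (false ∷ w) = true ∷ φ w

-- The conjugate of φ: 1 followed by `φ′ w` equals `φ w` followed by 1. A factor `ψ x` already takes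
-- the 1 at the cut point after x, so the rest of the word is `φ′` of the right context.
φ′ : Word → Word
φ′ [] = []
φ′ (true ∷ w) = false ∷ true ∷ φ′ w
φ′ (false ∷ w) = true ∷ φ′ w

-- ψ w = φ w ++ [ 1 ]
ψ : Word → Word
ψ w = true ∷ φ′ w

φ-++ : ∀ a b → φ (a ++ b) ≡ φ a ++ φ b
φ-++ [] b = refl
φ-++ (true ∷ a) b = cong (λ s → true ∷ false ∷ s) (φ-++ a b)
φ-++ (false ∷ a) b = cong (true ∷_) (φ-++ a b)

φ′-++ : ∀ a b → φ′ (a ++ b) ≡ φ′ a ++ φ′ b
φ′-++ [] b = refl
φ′-++ (true ∷ a) b = cong (λ s → false ∷ true ∷ s) (φ′-++ a b)
φ′-++ (false ∷ a) b = cong (true ∷_) (φ′-++ a b)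

φ-++-ψ : ∀ a b → φ a ++ ψ b ≡ ψ (a ++ b)
φ-++-ψ [] b = refl
φ-++-ψ (true ∷ a) b = cong (λ s → true ∷ false ∷ s) (φ-++-ψ a b)
φ-++-ψ (false ∷ a) b = cong (true ∷_) (φ-++-ψ a b)

ψ-++-φ′ : ∀ a b → ψ a ++ φ′ b ≡ ψ (a ++ b)
ψ-++-φ′ a b = cong (true ∷_) (sym (φ′-++ a b))

ψ-factor : ∀ l x r → φ l ++ ψ x ++ φ′ r ≡ ψ (l ++ x ++ r)
ψ-factor l x r = trans (cong (φ l ++_) (ψ-++-φ′ x r)) (φ-++-ψ l (x ++ r))

φ≢[] : w ≢ [] → φ w ≢ []
φ≢[] {[]} w≢[] _ = w≢[] refl
φ≢[] {true ∷ _} _ ()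
φ≢[] {false ∷ _} _ ()

φ′≢[] : w ≢ [] → φ′ w ≢ []
φ′≢[] {[]} w≢[] _ = w≢[] refl
φ′≢[] {true ∷ _} _ ()
φ′≢[] {false ∷ _} _ ()

φ-≡[] : φ w ≡ [] → w ≡ []
φ-≡[] {[]} _ = refl
φ-≡[] {true ∷ _} ()
φ-≡[] {false ∷ _} ()

φ′-≡[] : φ′ w ≡ [] → w ≡ []
φ′-≡[] {[]} _ = refl
φ′-≡[] {true ∷ _} ()
φ′-≡[] {false ∷ _} ()

No00-1∷ : No00 w → No00 (true ∷ w)
No00-1∷ nz [] b ()
No00-1∷ nz (_ ∷ a) b p = nz a b (∷-injectiveʳ p)

No00-01∷ : No00 (true ∷ w) → No00 (false ∷ true ∷ w)
No00-01∷ nz [] b ()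
No00-01∷ nz (_ ∷ a) b p = nz a b (∷-injectiveʳ p)

No00-ψ : ∀ w → No00 (ψ w)
No00-ψ [] [] b ()
No00-ψ [] (_ ∷ a) b p = contradiction (++-conicalʳ a _ (∷-injectiveʳ p)) λ ()
No00-ψ (true ∷ w) = No00-1∷ (No00-01∷ (No00-ψ w))
No00-ψ (false ∷ w) = No00-1∷ (No00-ψ w)

nonsingle : (∀ c → x ≢ [ c ]) → Closed′ x → ∃ λ u → CompleteReturn u x
nonsingle x≢c (single c) = contradiction refl (x≢c c)
nonsingle x≢c (return r) = _ , r

-- The letters 1 of ψ w mark the cut points of w.
ψ-cut : ∀ w a {b} → a ++ true ∷ b ≡ ψ w → ∃₂ λ l r → w ≡ l ++ r × a ≡ φ l × b ≡ φ′ r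
ψ-cut w [] p = [] , w , refl , refl , ∷-injectiveʳ p
ψ-cut [] (_ ∷ a) p = contradiction (++-conicalʳ a _ (∷-injectiveʳ p)) λ ()
ψ-cut (true ∷ w) (_ ∷ []) ()
ψ-cut (true ∷ w) (_ ∷ _ ∷ a) p
  with l , r , refl , refl , refl ← ψ-cut w a (∷-injectiveʳ (∷-injectiveʳ p))
  with refl ← ∷-injectiveˡ p | refl ← ∷-injectiveˡ (∷-injectiveʳ p) =
  true ∷ l , r , refl , refl , refl
ψ-cut (false ∷ w) (_ ∷ a) p
  with l , r , refl , refl , refl ← ψ-cut w a (∷-injectiveʳ p)
  with refl ← ∷-injectiveˡ p =
  false ∷ l , r , refl , refl , refl

-- The blocks 01 and 1 form a prefix code: the first letter of a block decides which one it is.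
φ′-prefix : ∀ v w {b} → φ′ v ++ b ≡ φ′ w → ∃ λ r → w ≡ v ++ r × b ≡ φ′ r
φ′-prefix [] w p = w , refl , p
φ′-prefix (true ∷ v) [] ()
φ′-prefix (true ∷ v) (true ∷ w) p
  with r , refl , q ← φ′-prefix v w (∷-injectiveʳ (∷-injectiveʳ p)) = r , refl , q
φ′-prefix (true ∷ v) (false ∷ w) ()
φ′-prefix (false ∷ v) [] ()
φ′-prefix (false ∷ v) (true ∷ w) ()
φ′-prefix (false ∷ v) (false ∷ w) p
  with r , refl , q ← φ′-prefix v w (∷-injectiveʳ p) = r , refl , q

ψ-occurrence : ∀ v w a {b} → a ++ ψ v ++ b ≡ ψ w → ∃₂ λ l r → w ≡ l ++ v ++ r × a ≡ φ l × b ≡ φ′ r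
ψ-occurrence v w a p
  with l , z , refl , refl , q ← ψ-cut w a p
  with r , refl , refl ← φ′-prefix v z q = l , r , refl , refl , refl

-- A border u becomes the border `ψ u`, and `ψ-occurrence` traces each occurrence of `ψ u` back to
-- one of u. For a single letter the new border is `ψ []`.
closed-ψ : Closed′ x → Closed′ (ψ x)
closed-ψ (single true) = return {u = [ true ]}
  ((λ ()) , (_ , (λ ()) , refl) , (true ∷ false ∷ [] , (λ ()) , refl) , only)
  where
  only : ∀ a b → a ++ true ∷ b ≡ true ∷ false ∷ true ∷ [] → a ≡ [] ⊎ b ≡ []
  only [] b p = inj₁ refl
  only (_ ∷ []) b ()
  only (_ ∷ _ ∷ []) b p = inj₂ (∷-injectiveʳ (∷-injectiveʳ (∷-injectiveʳ p)))
  only (_ ∷ _ ∷ _ ∷ a) b p = contradiction (++-conicalʳ a _ (∷-injectiveʳ (∷-injectiveʳ (∷-injectiveʳ p)))) λ ()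
closed-ψ (single false) = pair-closed true
closed-ψ (return {u} {x} (u≢[] , (b , b≢[] , p) , (a , a≢[] , q) , only)) = return {u = ψ u}
  ((λ ()) , (φ′ b , φ′≢[] b≢[] , trans (ψ-++-φ′ u b) (cong ψ p))
  , (φ a , φ≢[] a≢[] , trans (φ-++-ψ a u) (cong ψ q)) , only′)
  where
  only′ : ∀ c d → c ++ ψ u ++ d ≡ ψ x → c ≡ [] ⊎ d ≡ []
  only′ c d e with l , r , e′ , refl , refl ← ψ-occurrence u x c e with only l r (sym e′)
  ... | inj₁ refl = inj₁ refl
  ... | inj₂ refl = inj₂ refl

φ′-injective : φ′ v ≡ φ′ w → v ≡ w
φ′-injective {v} {w} p
  with r , refl , e ← φ′-prefix v w {[]} (trans (++-identityʳ _) p)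
  with refl ← φ′-≡[] (sym e) = sym (++-identityʳ v)

φ-injective : φ v ≡ φ w → v ≡ w
φ-injective {v} {w} p = φ′-injective (∷-injectiveʳ (begin
  ψ v            ≡⟨ cong ψ (++-identityʳ v) ⟨
  ψ (v ++ [])    ≡⟨ φ-++-ψ v [] ⟨
  φ v ++ ψ []    ≡⟨ cong (_++ ψ []) p ⟩
  φ w ++ ψ []    ≡⟨ φ-++-ψ w [] ⟩
  ψ (w ++ [])    ≡⟨ cong ψ (++-identityʳ w) ⟩
  ψ w            ∎))
  where open ≡-Reasoning

ψ≢single : w ≢ [] → ∀ c → ψ w ≢ [ c ]
ψ≢single w≢[] c p = φ′≢[] w≢[] (∷-injectiveʳ p)

-- A border of `ψ x` starts with 1, hence at a cut point. Being a suffix, it runs up to the last cut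
-- point, so it is `ψ v` for a suffix v of x.
closed-ψ⁻ : x ≢ [] → Closed′ (ψ x) → Closed′ x
closed-ψ⁻ {x} x≢[] closed with nonsingle (ψ≢single x≢[]) closed
... | [] , u≢[] , _ = contradiction refl u≢[]
... | false ∷ _ , _ , (_ , _ , ()) , _
... | true ∷ u , _ , (b , b≢[] , p) , (a , a≢[] , q) , only
  with y , v , x≡yv , refl , refl ← ψ-cut x a q
  with r , x≡vr , refl ← φ′-prefix v x (∷-injectiveʳ p) = go v r x≡yv x≡vr b≢[] only
  where
  go : ∀ v r → x ≡ y ++ v → x ≡ v ++ r → φ′ r ≢ [] →
       (∀ c d → c ++ ψ v ++ d ≡ ψ x → c ≡ [] ⊎ d ≡ []) → Closed′ x
  -- The border 1 occurs at every cut point, so x has no inner one and is a single letter.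
  go [] r x≡yv refl r≢[] only with r
  ... | [] = contradiction refl r≢[]
  ... | c ∷ [] = single c
  ... | c ∷ d ∷ s with only (φ [ c ]) (φ′ (d ∷ s)) (ψ-factor [ c ] [] (d ∷ s))
  ...   | inj₁ e = contradiction e (φ≢[] λ ())
  ...   | inj₂ e = contradiction e (φ′≢[] {d ∷ s} λ ())
  go v@(_ ∷ _) r x≡yv x≡vr r≢[] only = return {u = v}
    ((λ ()) , (r , (λ e → r≢[] (cong φ′ e)) , sym x≡vr)
    , (y , (λ e → a≢[] (cong φ e)) , sym x≡yv) , only′)
    where
    only′ : ∀ c d → c ++ v ++ d ≡ x → c ≡ [] ⊎ d ≡ []
    only′ c d e with only (φ c) (φ′ d) (trans (ψ-factor c v d) (cong ψ e))
    ... | inj₁ e′ = inj₁ (φ-≡[] e′)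
    ... | inj₂ e′ = inj₂ (φ′-≡[] e′)

-- Counting

HasSize : (A → Set) → ℕ → Set
HasSize {A} P n = ∃ λ (xs : List A) → Unique xs × length xs ≡ n × (∀ x → x ∈ xs ⇔ P x)

unique-map : {f : A → B} → (∀ {x y} → P x → P y → f x ≡ f y → x ≡ y) →
             ∀ {xs} → All P xs → Unique xs → Unique (map f xs)
unique-map inj [] [] = []
unique-map inj (px ∷ pxs) (x∉xs ∷ u) =
  All.map⁺ (All.zipWith (λ (x≢y , py) e → x≢y (inj px py e)) (x∉xs , pxs)) ∷ unique-map inj pxs u

HasSize-map : (f : A → B) → (∀ {x y} → P x → P y → f x ≡ f y → x ≡ y) →
              (∀ {x} → P x → Q (f x)) → (∀ {y} → Q y → ∃ λ x → P x × f x ≡ y) →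
              HasSize P n → HasSize Q n
HasSize-map {P = P} {Q = Q} f inj fP surj (xs , u , refl , mem) =
  map f xs , unique-map inj (All.tabulate (to (mem _))) u , length-map f xs , λ y → mk⇔ (fwd y) (bwd y)
  where
  fwd : ∀ y → y ∈ map f xs → Q y
  fwd y y∈ with x , x∈ , refl ← ∈-map⁻ f y∈ = fP (to (mem x) x∈)
  bwd : ∀ y → Q y → y ∈ map f xs
  bwd y qy with x , px , refl ← surj qy = ∈-map⁺ f (from (mem x) px)

HasSize-cong : (∀ x → P x ⇔ Q x) → HasSize P n → HasSize Q n
HasSize-cong eq (xs , u , l , mem) =
  xs , u , l , λ x → mk⇔ (to (eq x) ∘ to (mem x)) (from (mem x) ∘ from (eq x))

HasSize-∅ : (∀ x → ¬ P x) → HasSize P 0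
HasSize-∅ ¬P = [] , [] , refl , λ x → mk⇔ (λ ()) (λ px → contradiction px (¬P x))

HasSize-insert : ∀ (x : A) → ¬ P x → HasSize P n → HasSize (λ y → y ≡ x ⊎ P y) (suc n)
HasSize-insert x ¬Px (xs , u , refl , mem) =
  x ∷ xs , All.tabulate (λ y∈ x≡y → ¬Px (to (mem x) (subst (_∈ xs) (sym x≡y) y∈))) ∷ u , refl ,
  λ y → mk⇔ (λ { (here y≡x) → inj₁ y≡x ; (there y∈) → inj₂ (to (mem y) y∈) })
            (λ { (inj₁ y≡x) → here y≡x ; (inj₂ py) → there (from (mem y) py) })

HasSize-⊎ : (∀ {x} → P x → ¬ Q x) → HasSize P m → HasSize Q n → HasSize (λ x → P x ⊎ Q x) (m + n)
HasSize-⊎ disj (xs , u , refl , mem) (ys , v , refl , mem′) =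
  xs ++ ys , Unique.++⁺ u v (λ (x∈ , x∈′) → disj (to (mem _) x∈) (to (mem′ _) x∈′)) , length-++ xs ,
  λ x → mk⇔ (λ x∈ → case (∈-++⁻ xs x∈))
            (λ { (inj₁ p) → ∈-++⁺ˡ (from (mem x) p) ; (inj₂ q) → ∈-++⁺ʳ xs (from (mem′ x) q) })
  where
  case : ∀ {x} → x ∈ xs ⊎ x ∈ ys → _ ⊎ _
  case (inj₁ x∈) = inj₁ (to (mem _) x∈)
  case (inj₂ x∈) = inj₂ (to (mem′ _) x∈)

unique-remove : ∀ {x : A} {xs} → Unique xs → x ∈ xs →
       ∃ λ ys → Unique ys × length xs ≡ suc (length ys) × (∀ y → y ∈ ys ⇔ (y ∈ xs × y ≢ x))
unique-remove {x = x} (x∉xs ∷ u) (here refl) = _ , u , refl ,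
  λ y → mk⇔ (λ y∈ → there y∈ , λ y≡x → All.lookup x∉xs y∈ (sym y≡x))
            (λ { (here y≡x , y≢x) → contradiction y≡x y≢x ; (there y∈ , _) → y∈ })
unique-remove {x = x} {z ∷ xs} (z∉xs ∷ u) (there x∈) with ys , v , l , mem ← unique-remove u x∈ =
  z ∷ ys , All.tabulate (λ y∈ → All.lookup z∉xs (proj₁ (to (mem _) y∈))) ∷ v , cong suc l ,
  λ y → mk⇔ (λ { (here refl) → here refl , All.lookup z∉xs x∈
               ; (there y∈) → there (proj₁ (to (mem y) y∈)) , proj₂ (to (mem y) y∈) })
            (λ { (here y≡z , _) → here y≡z ; (there y∈ , y≢x) → there (from (mem y) (y∈ , y≢x)) })

HasSize-remove : ∀ {x : A} → P x → HasSize P (suc n) → HasSize (λ y → P y × y ≢ x) n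
HasSize-remove px (xs , u , l , mem) with ys , v , l′ , mem′ ← unique-remove u (from (mem _) px) =
  ys , v , cong (_∸ 1) (trans (sym l′) l) ,
  λ y → mk⇔ (λ y∈ → let y∈xs , y≢x = to (mem′ y) y∈ in to (mem y) y∈xs , y≢x)
            (λ (py , y≢x) → from (mem′ y) (from (mem y) py , y≢x))

-- Carries a count over to the arbitrary duplicate-free lists of the theorem. The induction removes
-- a common element from both enumerations.
HasSize-unique : HasSize P m → HasSize P n → m ≡ n
HasSize-unique {n = n} ([] , u , refl , mem) ([] , _ , refl , _) = refl
HasSize-unique ([] , u , refl , mem) (y ∷ _ , _ , refl , mem′)
  with () ← from (mem y) (to (mem′ y) (here refl))
HasSize-unique {m = suc m} {n = zero} (x ∷ xs , u , refl , mem) ([] , v , refl , mem′)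
  with () ← from (mem′ x) (to (mem x) (here refl))
HasSize-unique {m = suc m} {n = suc n} h@(x ∷ xs , u , refl , mem) h′@(_ ∷ _ , v , refl , mem′) =
  cong suc (HasSize-unique (HasSize-remove px h) (HasSize-remove px h′))
  where px = to (mem x) (here refl)

-- Maximal closed factors

-- (l , x , r) stands for the occurrence of x after l in l ++ x ++ r.
Factor : Set
Factor = Word × Word × Word

-- The boundary cases i = 1 and j = N become vacuous: an empty context has no adjacent letter.
LeftMaximal RightMaximal : Word → Word → Set
LeftMaximal l x = ∀ l′ c → l ≡ l′ ∷ʳ c → ¬ Closed′ (c ∷ x)
RightMaximal x r = ∀ c r′ → r ≡ c ∷ r′ → ¬ Closed′ (x ∷ʳ c)

record MaxClosed (w : Word) (f : Factor) : Set where
  constructor maxClosed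
  before = proj₁ f
  middle = proj₁ (proj₂ f)
  after = proj₂ (proj₂ f)
  field
    factor : before ++ middle ++ after ≡ w
    closed : Closed′ middle
    left   : LeftMaximal before middle
    right  : RightMaximal middle after

reverse-∷ʳ : ∀ (a : Word) {c} → reverse (a ∷ʳ c) ≡ c ∷ reverse a
reverse-∷ʳ a {c} = reverse-++ a [ c ]

right⇒left-reverse : RightMaximal x r → LeftMaximal (reverse r) (reverse x)
right⇒left-reverse {x} {r} right l′ c e closed = right c (reverse l′) r≡
  (Closed′-reverse⁻ (subst Closed′ (sym (reverse-∷ʳ x)) closed))
  where
  r≡ : r ≡ c ∷ reverse l′
  r≡ = trans (sym (reverse-involutive r)) (trans (cong reverse e) (reverse-∷ʳ l′))

left⇒right-reverse : LeftMaximal l x → RightMaximal (reverse x) (reverse l)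
left⇒right-reverse {l} {x} left c r′ e closed = left (reverse r′) c l≡
  (Closed′-reverse⁻ (subst Closed′ (sym (unfold-reverse c x)) closed))
  where
  l≡ : l ≡ reverse r′ ∷ʳ c
  l≡ = trans (sym (reverse-involutive l)) (trans (cong reverse e) (unfold-reverse c r′))

left-reverse⁻ : LeftMaximal (reverse r) (reverse x) → RightMaximal x r
left-reverse⁻ {r} {x} left =
  subst₂ RightMaximal (reverse-involutive x) (reverse-involutive r) (left⇒right-reverse left)

reverseFactor : Factor → Factor
reverseFactor (l , x , r) = reverse r , reverse x , reverse l

MaxClosed-reverse : ∀ {f} → MaxClosed w f → MaxClosed (reverse w) (reverseFactor f)
MaxClosed-reverse {f = l , x , r} (maxClosed refl closed left right) =
  maxClosed (sym (reverse-++₃ l x r)) (Closed′-reverse closed)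
    (right⇒left-reverse right) (left⇒right-reverse left)

-- Reversal exchanges φ and `φ′`, and the two expressions of ψ, by φ with a final 1 and by `φ′` with
-- an initial 1, go into each other. Thus right maximality follows from left maximality.
reverse-ψ : ∀ w → reverse (ψ w) ≡ ψ (reverse w)
reverse-φ′ : ∀ w → reverse (φ′ w) ≡ φ (reverse w)

reverse-φ′ [] = refl
reverse-φ′ (true ∷ w) = begin
  reverse (false ∷ true ∷ φ′ w)             ≡⟨ reverse-++ (false ∷ true ∷ []) (φ′ w) ⟩
  reverse (φ′ w) ++ true ∷ false ∷ []       ≡⟨ cong (_++ φ [ true ]) (reverse-φ′ w) ⟩
  φ (reverse w) ++ φ [ true ]               ≡⟨ φ-++ (reverse w) [ true ] ⟨
  φ (reverse w ∷ʳ true)                     ≡⟨ cong φ (unfold-reverse true w) ⟨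
  φ (reverse (true ∷ w))                    ∎
  where open ≡-Reasoning
reverse-φ′ (false ∷ w) = begin
  reverse (true ∷ φ′ w)                     ≡⟨ unfold-reverse true (φ′ w) ⟩
  reverse (φ′ w) ++ true ∷ []               ≡⟨ cong (_++ φ [ false ]) (reverse-φ′ w) ⟩
  φ (reverse w) ++ φ [ false ]              ≡⟨ φ-++ (reverse w) [ false ] ⟨
  φ (reverse w ∷ʳ false)                    ≡⟨ cong φ (unfold-reverse false w) ⟨
  φ (reverse (false ∷ w))                   ∎
  where open ≡-Reasoning

reverse-ψ w = begin
  reverse (true ∷ φ′ w)      ≡⟨ unfold-reverse true (φ′ w) ⟩
  reverse (φ′ w) ++ ψ []     ≡⟨ cong (_++ ψ []) (reverse-φ′ w) ⟩
  φ (reverse w) ++ ψ []      ≡⟨ φ-++-ψ (reverse w) [] ⟩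
  ψ (reverse w ++ [])        ≡⟨ cong ψ (++-identityʳ _) ⟩
  ψ (reverse w)              ∎
  where open ≡-Reasoning

-- Maximality under ψ

closed-0ψ : Closed′ (false ∷ ψ x) → Closed′ (ψ (true ∷ x))
closed-0ψ {x} = closed-1∷ (λ ()) (No00-01∷ (No00-ψ x))

closed-0ψ⁻ : x ≢ [] → Closed′ (ψ (true ∷ x)) → Closed′ (false ∷ ψ x)
closed-0ψ⁻ {x} x≢[] = closed-1∷⁻ (λ ()) (ψ≢single x≢[] true) (No00-01∷ (No00-ψ x))

φ-∷ʳ-injective : ∀ l c {l′ d} → φ (l ∷ʳ c) ≡ l′ ∷ʳ d → d ≡ not c
φ-∷ʳ-injective l true {l′} p =
  sym (∷ʳ-injectiveʳ (φ l ∷ʳ true) l′ (trans (++-assoc (φ l) _ _) (trans (sym (φ-++ l [ true ])) p)))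
φ-∷ʳ-injective l false {l′} p = sym (∷ʳ-injectiveʳ (φ l) l′ (trans (sym (φ-++ l [ false ])) p))

-- If l ends with 0, extending `ψ x` by one letter gives the full image `ψ (false ∷ x)`. If l ends
-- with 1, it only gives 0 `ψ x`, half a block short of an image, and `closed-0ψ` adds the missing
-- 1.
left-ψ : x ≢ [] → LeftMaximal l x → LeftMaximal (φ l) (ψ x)
left-ψ {x} {l} x≢[] left l′ c e closed with initLast l
... | [] = contradiction (sym e) (∷ʳ≢[] l′)
... | m ∷ʳ′ false with refl ← φ-∷ʳ-injective m false e =
  left m false refl (closed-ψ⁻ (λ ()) closed)
... | m ∷ʳ′ true with refl ← φ-∷ʳ-injective m true e =
  left m true refl (closed-ψ⁻ (λ ()) (closed-0ψ closed))

left-ψ⁻ : x ≢ [] → LeftMaximal (φ l) (ψ x) → LeftMaximal l x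
left-ψ⁻ x≢[] left m false refl closed = left (φ m) true (φ-++ m [ false ]) (closed-ψ closed)
left-ψ⁻ x≢[] left m true refl closed =
  left (φ m ∷ʳ true) false (trans (φ-++ m [ true ]) (sym (++-assoc (φ m) _ _)))
    (closed-0ψ⁻ x≢[] (closed-ψ closed))

right-ψ : x ≢ [] → RightMaximal x r → RightMaximal (ψ x) (φ′ r)
right-ψ {x} {r} x≢[] right = left-reverse⁻ {φ′ r} {ψ x} (subst₂ LeftMaximal (sym (reverse-φ′ r)) (sym (reverse-ψ x))
  (left-ψ (reverse≢[] x≢[]) (right⇒left-reverse right)))

right-ψ⁻ : x ≢ [] → RightMaximal (ψ x) (φ′ r) → RightMaximal x r
right-ψ⁻ {x} {r} x≢[] right = left-reverse⁻ (left-ψ⁻ (reverse≢[] x≢[])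
  (subst₂ LeftMaximal (reverse-φ′ r) (reverse-ψ x) (right⇒left-reverse {ψ x} {φ′ r} right)))

ψFactor : Factor → Factor
ψFactor (l , x , r) = φ l , ψ x , φ′ r

ψFactor-injective : ∀ {f g} → ψFactor f ≡ ψFactor g → f ≡ g
ψFactor-injective p = cong₂ _,_ (φ-injective (cong proj₁ p))
  (cong₂ _,_ (φ′-injective (∷-injectiveʳ (cong (proj₁ ∘ proj₂) p)))
             (φ′-injective (cong (proj₂ ∘ proj₂) p)))

MaxClosed-ψ : ∀ {f} → MaxClosed w f → MaxClosed (ψ w) (ψFactor f)
MaxClosed-ψ {f = l , x , r} (maxClosed refl closed left right) =
  maxClosed (ψ-factor l x r) (closed-ψ closed) (left-ψ x≢[] left) (right-ψ x≢[] right)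
  where x≢[] = Closed′⇒≢[] closed

-- A longer closed factor starting with 0 cannot be a prefix of w, so a 1 precedes it, and by
-- `closed-1∷` it stays closed when extended by that 1.
nonsingle⇒starts-with-1 : No00 w → (∀ v → w ≢ false ∷ v) → (∀ c → x ≢ [ c ]) →
  l ++ x ++ r ≡ w → Closed′ x → LeftMaximal l x → ∃ λ x′ → x ≡ true ∷ x′
nonsingle⇒starts-with-1 {x = []} nz w≢0 x≢c e closed left = contradiction refl (Closed′⇒≢[] closed)
nonsingle⇒starts-with-1 {x = true ∷ x} nz w≢0 x≢c e closed left = x , refl
nonsingle⇒starts-with-1 {x = false ∷ []} nz w≢0 x≢c e closed left = contradiction refl (x≢c false)
nonsingle⇒starts-with-1 {x = false ∷ x@(_ ∷ _)} {l = []} nz w≢0 x≢c e closed left = contradiction (sym e) (w≢0 _)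
nonsingle⇒starts-with-1 {x = false ∷ x@(_ ∷ _)} {l = l@(_ ∷ _)} {r = r} nz w≢0 x≢c refl closed left
  with l′ , l≡ ← one-before-zero l (λ ()) nz =
  contradiction (closed-1∷ (λ ()) (No00-factor l r nz) closed) (left l′ true l≡)

nonsingle⇒ends-with-1 : No00 w → (∀ v → w ≢ v ∷ʳ false) → (∀ c → x ≢ [ c ]) →
  l ++ x ++ r ≡ w → Closed′ x → RightMaximal x r → ∃ λ x′ → x ≡ x′ ∷ʳ true
nonsingle⇒ends-with-1 {w} {x} {l} {r} nz w≢0 x≢c refl closed right
  with x′ , e ← nonsingle⇒starts-with-1 (No00-reverse nz)
    (λ v p → w≢0 (reverse v) (trans (sym (reverse-involutive w)) (trans (cong reverse p) (unfold-reverse false v))))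
    (λ c p → x≢c c (trans (sym (reverse-involutive x)) (cong reverse p)))
    (sym (reverse-++₃ l x r)) (Closed′-reverse closed) (right⇒left-reverse right) =
  reverse x′ , trans (sym (reverse-involutive x)) (trans (cong reverse e) (unfold-reverse true x′))

ψ-starts-with-1 : ∀ w v → ψ w ≢ false ∷ v
ψ-starts-with-1 w v ()

ψ-ends-with-1 : ∀ w v → ψ w ≢ v ∷ʳ false
ψ-ends-with-1 w v p = ψ-starts-with-1 (reverse w) (reverse v) (begin
  ψ (reverse w)        ≡⟨ reverse-ψ w ⟨
  reverse (ψ w)        ≡⟨ cong reverse p ⟩
  reverse (v ∷ʳ false) ≡⟨ reverse-∷ʳ v ⟩
  false ∷ reverse v    ∎)
  where open ≡-Reasoning

ψ-≡-∷ʳ : ∀ x → φ x ∷ʳ true ≡ ψ x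
ψ-≡-∷ʳ x = trans (φ-++-ψ x []) (cong ψ (++-identityʳ x))

Letter : Factor → Set
Letter (_ , x , _) = ∃ λ c → x ≡ [ c ]

MaxClosed-ψ⁻ : ∀ {f} → MaxClosed (ψ w) f → ¬ Letter f → ∃ λ g → MaxClosed w g × ψFactor g ≡ f
MaxClosed-ψ⁻ {w} {l , x , r} (maxClosed e closed left right) x≢c
  with x₁ , refl ← nonsingle⇒starts-with-1 (No00-ψ w) (ψ-starts-with-1 w) (λ c p → x≢c (c , p)) e closed left
  with x₂ , x≡ ← nonsingle⇒ends-with-1 {l = l} (No00-ψ w) (ψ-ends-with-1 w) (λ c p → x≢c (c , p)) e closed right
  with l′ , z , refl , refl , p ← ψ-cut w l e
  -- The final 1 of x is the second cut point, located in `ψ z`, where z is the part of w after l′.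
  with x′ , r′ , refl , refl , refl ← ψ-cut z x₂
         (trans (sym (++-assoc x₂ _ _)) (trans (cong (_++ r) (sym x≡)) (cong (true ∷_) p)))
  with refl ← ∷-injectiveʳ (trans x≡ (ψ-≡-∷ʳ x′)) =
  let x′≢[] = λ { refl → x≢c (true , refl) } in
  (l′ , x′ , r′) , maxClosed refl (closed-ψ⁻ x′≢[] closed) (left-ψ⁻ x′≢[] left) (right-ψ⁻ x′≢[] right) , refl

HasSize-ψ : HasSize (MaxClosed w) m → HasSize (λ f → MaxClosed (ψ w) f × Letter f) n →
            HasSize (MaxClosed (ψ w)) (m + n)
HasSize-ψ {w} hw hl = HasSize-cong (λ f → mk⇔ (fwd f) (bwd f))
  (HasSize-⊎ disjoint (HasSize-map ψFactor (λ _ _ → ψFactor-injective) image (λ q → q) hw) hl)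
  where
  Image : Factor → Set
  Image f = ∃ λ g → MaxClosed w g × ψFactor g ≡ f
  image : ∀ {f} → MaxClosed w f → Image (ψFactor f)
  image h = _ , h , refl
  disjoint : ∀ {f} → Image f → ¬ (MaxClosed (ψ w) f × Letter f)
  disjoint (_ , h , refl) (_ , c , p) = ψ≢single (Closed′⇒≢[] (MaxClosed.closed h)) c p
  fwd : ∀ f → Image f ⊎ (MaxClosed (ψ w) f × Letter f) → MaxClosed (ψ w) f
  fwd f (inj₁ (_ , h , refl)) = MaxClosed-ψ h
  fwd f (inj₂ (h , _)) = h
  bwd : ∀ f → MaxClosed (ψ w) f → Image f ⊎ (MaxClosed (ψ w) f × Letter f)
  bwd f@(_ , [] , _) h = contradiction refl (Closed′⇒≢[] (MaxClosed.closed h))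
  bwd f@(_ , c ∷ [] , _) h = inj₂ (h , c , refl)
  bwd f@(_ , _ ∷ _ ∷ _ , _) h = inj₁ (MaxClosed-ψ⁻ h λ ())

-- Isolated letters

lastOr : Bool → Word → Bool
lastOr p [] = p
lastOr p (c ∷ w) = lastOr c w

lastOr-∷ʳ : ∀ p l {c} → lastOr p (l ∷ʳ c) ≡ c
lastOr-∷ʳ p [] = refl
lastOr-∷ʳ p (d ∷ l) = lastOr-∷ʳ d l

-- A letter is a maximal closed factor iff it differs from its neighbours, since cc is closed and cd
-- is not for distinct letters. The parameter p stands for the letter before w and lets the
-- recursion along w hand on the previous letter.
Isolated : Bool → Word → Factor → Set
Isolated p w (l , x , r) = ∃ λ c → x ≡ [ c ] × l ++ x ++ r ≡ w × lastOr p l ≢ c × (∀ r′ → r ≢ c ∷ r′)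

isolatedHead : Bool → Bool → Word → ℕ
isolatedHead true true _ = 0
isolatedHead false false _ = 0
isolatedHead true false (false ∷ _) = 0
isolatedHead false true (true ∷ _) = 0
isolatedHead _ _ _ = 1

#isolated : Bool → Word → ℕ
#isolated p [] = 0
#isolated p (c ∷ w) = isolatedHead p c w + #isolated c w

IsolatedHead : Bool → Bool → Word → Factor → Set
IsolatedHead p c w f = f ≡ ([] , [ c ] , w) × p ≢ c × (∀ r → w ≢ c ∷ r)

HasSize-IsolatedHead : ∀ p c w → HasSize (IsolatedHead p c w) (isolatedHead p c w)
HasSize-IsolatedHead = go
  where
  one : ∀ {p c w} → p ≢ c → (∀ r → w ≢ c ∷ r) → HasSize (IsolatedHead p c w) 1
  one p≢c w≢c = HasSize-cong (λ f → mk⇔ (λ { (inj₁ e) → e , p≢c , w≢c ; (inj₂ ()) }) (inj₁ ∘ proj₁))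
    (HasSize-insert _ (λ ()) (HasSize-∅ {P = λ _ → ⊥} λ _ ()))
  go : ∀ p c w → HasSize (IsolatedHead p c w) (isolatedHead p c w)
  go true true w = HasSize-∅ λ _ (_ , p≢c , _) → p≢c refl
  go false false w = HasSize-∅ λ _ (_ , p≢c , _) → p≢c refl
  go true false (false ∷ w) = HasSize-∅ λ _ (_ , _ , w≢c) → w≢c w refl
  go false true (true ∷ w) = HasSize-∅ λ _ (_ , _ , w≢c) → w≢c w refl
  go true false [] = one (λ ()) λ _ ()
  go true false (true ∷ w) = one (λ ()) λ _ ()
  go false true [] = one (λ ()) λ _ ()
  go false true (false ∷ w) = one (λ ()) λ _ ()

shift : Bool → Factor → Factor
shift c (l , x , r) = c ∷ l , x , r

HasSize-Isolated : ∀ p w → HasSize (Isolated p w) (#isolated p w)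
HasSize-Isolated p [] = HasSize-∅ λ { (l , x , r) (c , refl , e , _) → contradiction (++-conicalʳ l _ e) λ () }
HasSize-Isolated p (c ∷ w) = HasSize-cong (λ f → mk⇔ (fwd f) (bwd f))
  (HasSize-⊎ (λ { (refl , _) (_ , _ , ()) }) (HasSize-IsolatedHead p c w)
    (HasSize-map (shift c) (λ { _ _ refl → refl }) (λ {f} h → f , h , refl) (λ q → q) (HasSize-Isolated c w)))
  where
  Shifted : Factor → Set
  Shifted f = ∃ λ g → Isolated c w g × shift c g ≡ f
  fwd : ∀ f → IsolatedHead p c w f ⊎ Shifted f → Isolated p (c ∷ w) f
  fwd f (inj₁ (refl , p≢c , w≢c)) = c , refl , refl , p≢c , w≢c
  fwd f (inj₂ (_ , (d , refl , refl , left , right) , refl)) = d , refl , refl , left , right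
  bwd : ∀ f → Isolated p (c ∷ w) f → IsolatedHead p c w f ⊎ Shifted f
  bwd ([] , _) (_ , refl , refl , left , right) = inj₁ (refl , left , right)
  bwd (_ ∷ l , x , r) (d , refl , refl , left , right) = inj₂ (_ , (d , refl , refl , left , right) , refl)

-- The previous letter is set to 0 at the start, which is harmless as ψ w starts with 1.
isolated⇔maxClosed : ∀ w f → Isolated false (ψ w) f ⇔ (MaxClosed (ψ w) f × Letter f)
isolated⇔maxClosed w f@(l , x , r) = mk⇔ fwd bwd
  where
  fwd : Isolated false (ψ w) f → MaxClosed (ψ w) f × Letter f
  fwd (c , refl , e , left , right) = maxClosed e (single c)
    (λ { l′ d refl closed → left (trans (lastOr-∷ʳ false l′) (closed-pair closed)) })
    (λ { d r′ refl closed → right r′ (cong (_∷ r′) (sym (closed-pair closed))) }) , c , refl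
  left′ : ∀ l c → l ++ c ∷ r ≡ ψ w → LeftMaximal l [ c ] → lastOr false l ≢ c
  left′ l c e left p with initLast l
  left′ .[] .false () left refl | []
  ... | l′ ∷ʳ′ d with refl ← trans (sym (lastOr-∷ʳ false l′)) p = left l′ d refl (pair-closed d)
  bwd : MaxClosed (ψ w) f × Letter f → Isolated false (ψ w) f
  bwd (maxClosed e closed left right , c , refl) =
    c , refl , e , left′ l c e left , λ { r′ refl → right c r′ refl (pair-closed c) }

ψ-size : HasSize (MaxClosed w) m → HasSize (MaxClosed (ψ w)) (m + #isolated false (ψ w))
ψ-size {w} h = HasSize-ψ h (HasSize-cong (isolated⇔maxClosed w) (HasSize-Isolated false (ψ w)))

-- Removing a first letter 1

Proper : Factor → Set
Proper (l , x , r) = l ≡ [] → x ≢ [ true ] × x ≢ true ∷ false ∷ true ∷ []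

dropHead : Factor → Factor
dropHead (_ ∷ l , x , r) = l , x , r
dropHead ([] , _ ∷ x , r) = [] , x , r
dropHead ([] , [] , r) = [] , [] , r

LeftMaximal-∷ : ∀ {c} → l ≢ [] → LeftMaximal l x → LeftMaximal (c ∷ l) x
LeftMaximal-∷ l≢[] left [] d refl = contradiction refl l≢[]
LeftMaximal-∷ l≢[] left (_ ∷ l′) d refl = left l′ d refl

LeftMaximal-∷⁻ : ∀ {c} → LeftMaximal (c ∷ l) x → LeftMaximal l x
LeftMaximal-∷⁻ left l′ d refl = left (_ ∷ l′) d refl

LeftMaximal-[] : LeftMaximal [] x
LeftMaximal-[] l c e = contradiction (sym e) (∷ʳ≢[] l)

-- By `closed-1∷` and `closed-1∷⁻`, closed prefixes 10y correspond to closed prefixes 0y, also with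
-- a further letter appended, so right maximality is kept. The prefixes 1 and 101 have to be
-- excluded because they leave the empty word and 01.
HasSize-dropHead : No00 (false ∷ w) → HasSize (λ f → MaxClosed (true ∷ false ∷ w) f × Proper f) n →
                   HasSize (MaxClosed (false ∷ w)) n
HasSize-dropHead {w} nz = HasSize-map dropHead inj fwd surj
  where
  Kept : Factor → Set
  Kept f = MaxClosed (true ∷ false ∷ w) f × Proper f

  factor-nz : ∀ y {r} → false ∷ y ++ r ≡ false ∷ w → No00 (false ∷ y)
  factor-nz y e = No00-factor [] _ (subst No00 (sym e) nz)

  right-nz : ∀ y {c r} → false ∷ y ++ c ∷ r ≡ false ∷ w → No00 (false ∷ y ∷ʳ c)
  right-nz y e = factor-nz (y ∷ʳ _) (trans (cong (false ∷_) (++-assoc y _ _)) e)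

  -- Otherwise the second factor would extend to the left to the first one, which is closed.
  clash : ∀ {c x r x′ r′} → Kept ([] , c ∷ x , r) → Kept ([ true ] , x′ , r′) → x ≢ x′
  clash (maxClosed e closed _ _ , _) (maxClosed _ _ left _ , _) refl = left [] _ (cong [_] (sym (∷-injectiveˡ e))) closed

  inj : ∀ {f g} → Kept f → Kept g → dropHead f ≡ dropHead g → f ≡ g
  inj {_ ∷ l , x , r} {_ ∷ _ , _} (maxClosed e _ _ _ , _) (maxClosed e′ _ _ _ , _) refl
    with refl ← trans (∷-injectiveˡ e) (sym (∷-injectiveˡ e′)) = refl
  inj {_ ∷ _ , _} {[] , [] , _} _ (maxClosed _ closed _ _ , _) refl = contradiction refl (Closed′⇒≢[] closed)
  inj {_ ∷ _ , _} {[] , _ ∷ _ , _} pf@(maxClosed e _ _ _ , _) pg refl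
    with refl ← ∷-injectiveˡ e = contradiction refl (clash pg pf)
  inj {[] , [] , _} {_} (maxClosed _ closed _ _ , _) _ _ = contradiction refl (Closed′⇒≢[] closed)
  inj {[] , _ ∷ _ , _} {_ ∷ _ , _} pf pg@(maxClosed e _ _ _ , _) refl
    with refl ← ∷-injectiveˡ e = contradiction refl (clash pf pg)
  inj {[] , _ ∷ _ , _} {[] , [] , _} _ (maxClosed _ closed _ _ , _) _ = contradiction refl (Closed′⇒≢[] closed)
  inj {[] , _ ∷ _ , _} {[] , _ ∷ _ , _} (maxClosed e _ _ _ , _) (maxClosed e′ _ _ _ , _) refl
    with refl ← trans (∷-injectiveˡ e) (sym (∷-injectiveˡ e′)) = refl

  fwd : ∀ {f} → Kept f → MaxClosed (false ∷ w) (dropHead f)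
  fwd {_ ∷ l , x , r} (maxClosed e closed left right , _) = maxClosed (∷-injectiveʳ e) closed (LeftMaximal-∷⁻ left) right
  fwd {[] , [] , r} (maxClosed _ closed _ _ , _) = contradiction refl (Closed′⇒≢[] closed)
  fwd {[] , true ∷ [] , r} (maxClosed e closed left right , proper) = contradiction refl (proj₁ (proper refl))
  fwd {[] , true ∷ false ∷ [] , r} (maxClosed e closed left right , proper) with () ← closed-pair closed
  fwd {[] , true ∷ false ∷ y@(_ ∷ _) , r} (maxClosed e closed left right , proper) =
    maxClosed (∷-injectiveʳ e)
      (closed-1∷⁻ (λ ()) (λ { refl → proj₂ (proper refl) refl }) (factor-nz y (∷-injectiveʳ e)) closed)
      LeftMaximal-[]
      (λ { c r′ refl closed′ → right c r′ refl (closed-1∷ (λ ()) (right-nz y (∷-injectiveʳ e)) closed′) })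

  surj : ∀ {g} → MaxClosed (false ∷ w) g → ∃ λ f → Kept f × dropHead f ≡ g
  surj {_ ∷ l , x , r} (maxClosed e closed left right) =
    (true ∷ _ ∷ l , x , r) , (maxClosed (cong (true ∷_) e) closed (LeftMaximal-∷ (λ ()) left) right , λ ()) , refl
  surj {[] , [] , r} (maxClosed _ closed _ _) = contradiction refl (Closed′⇒≢[] closed)
  -- The letter 0 alone does not absorb the restored 1, because 10 is not closed. Longer prefixes
  -- do.
  surj {[] , false ∷ [] , r} (maxClosed e closed left right) =
    ([ true ] , [ false ] , r) , (maxClosed (cong (true ∷_) e) closed left′ right , λ ()) , refl
    where
    left′ : LeftMaximal [ true ] [ false ]
    left′ [] _ refl closed with () ← closed-pair closed
    left′ (_ ∷ l) c e _ = ∷ʳ≢[] l (sym (∷-injectiveʳ e))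
  surj {[] , false ∷ y@(d ∷ y′) , r} (maxClosed e closed left right) =
    ([] , true ∷ false ∷ y , r)
    , (maxClosed (cong (true ∷_) e) (closed-1∷ (λ ()) (factor-nz y e) closed) LeftMaximal-[]
        (λ { c r′ refl closed′ → right c r′ refl
               (closed-1∷⁻ (λ ()) (λ p → ∷ʳ≢[] y′ (∷-injectiveʳ p)) (right-nz y e) closed′) })
      , λ _ → (λ ()) , (λ { refl → case-01 closed }))
    , refl
    where
    case-01 : ¬ Closed′ (false ∷ true ∷ [])
    case-01 c with () ← closed-pair c

letter-1 : MaxClosed (true ∷ false ∷ w) ([] , [ true ] , false ∷ w)
letter-1 {w} = maxClosed refl (single true) LeftMaximal-[] right
  where
  right : RightMaximal [ true ] (false ∷ w)
  right _ _ refl closed with () ← closed-pair closed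

-- The chain is 11, its image 10101, the remainder 0101, and the reversal of that.
closed-1010 : Closed′ (true ∷ false ∷ true ∷ false ∷ [])
closed-1010 = Closed′-reverse (closed-0ψ⁻ {[ true ]} (λ ()) (closed-ψ (pair-closed true)))

¬closed-1011 : ¬ Closed′ (true ∷ false ∷ true ∷ true ∷ [])
¬closed-1011 c with () ← closed-pair (closed-ψ⁻ {true ∷ [ false ]} (λ ()) c)

-- The prefix 101 extends to the closed 1010, so the letter 1 is the only improper maximal factor.
1010-size : No00 (false ∷ true ∷ false ∷ w) → HasSize (MaxClosed (true ∷ false ∷ true ∷ false ∷ w)) (suc n) →
            HasSize (MaxClosed (false ∷ true ∷ false ∷ w)) n
1010-size {w} nz h = HasSize-dropHead nz (HasSize-cong (λ f → mk⇔ fwd bwd) (HasSize-remove letter-1 h))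
  where
  W = true ∷ false ∷ true ∷ false ∷ w
  fwd : ∀ {f} → MaxClosed W f × f ≢ ([] , [ true ] , false ∷ true ∷ false ∷ w) → MaxClosed W f × Proper f
  fwd (h@(maxClosed e _ _ right) , f≢) = h , λ { refl →
    (λ { refl → f≢ (cong (λ r → [] , [ true ] , r) (∷-injectiveʳ e)) })
    , (λ { refl → right false w (∷-injectiveʳ (∷-injectiveʳ (∷-injectiveʳ e))) closed-1010 }) }
  bwd : ∀ {f} → MaxClosed W f × Proper f → MaxClosed W f × f ≢ ([] , [ true ] , false ∷ true ∷ false ∷ w)
  bwd (h , proper) = h , λ { refl → proj₁ (proper refl) refl }

-- Here 1011 = `ψ` of 10 is not closed, so 101 is maximal and is lost together with the letter 1.
1011-size : No00 (false ∷ true ∷ true ∷ w) → HasSize (MaxClosed (true ∷ false ∷ true ∷ true ∷ w)) (suc (suc n)) →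
            HasSize (MaxClosed (false ∷ true ∷ true ∷ w)) n
1011-size {w} nz h = HasSize-dropHead nz (HasSize-cong (λ f → mk⇔ fwd bwd)
  (HasSize-remove ((maxClosed refl (closed-ψ (single true)) LeftMaximal-[] right-101) , λ ())
    (HasSize-remove letter-1 h)))
  where
  W = true ∷ false ∷ true ∷ true ∷ w
  e₁ e₂ : Factor
  e₁ = [] , [ true ] , false ∷ true ∷ true ∷ w
  e₂ = [] , true ∷ false ∷ true ∷ [] , true ∷ w
  right-101 : RightMaximal (true ∷ false ∷ true ∷ []) (true ∷ w)
  right-101 _ _ refl = ¬closed-1011
  fwd : ∀ {f} → (MaxClosed W f × f ≢ e₁) × f ≢ e₂ → MaxClosed W f × Proper f
  fwd ((h@(maxClosed e _ _ _) , f≢e₁) , f≢e₂) = h , λ { refl →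
    (λ { refl → f≢e₁ (cong (λ r → [] , [ true ] , r) (∷-injectiveʳ e)) })
    , (λ { refl → f≢e₂ (cong (λ r → [] , true ∷ false ∷ true ∷ [] , r) (∷-injectiveʳ (∷-injectiveʳ (∷-injectiveʳ e)))) }) }
  bwd : ∀ {f} → MaxClosed W f × Proper f → (MaxClosed W f × f ≢ e₁) × f ≢ e₂
  bwd (h , proper) = (h , λ { refl → proj₁ (proper refl) refl }) , λ { refl → proj₂ (proper refl) refl }

-- The word is `τ 1`, the base of the recursion in `τ-size`.
01-size : HasSize (MaxClosed (false ∷ true ∷ [])) 2
01-size = HasSize-cong (λ f → mk⇔ (fwd f) (bwd f))
  (HasSize-insert _ (λ { (inj₁ ()) ; (inj₂ ()) }) (HasSize-insert _ (λ ()) (HasSize-∅ {P = λ _ → ⊥} λ _ ())))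
  where
  e₁ e₂ : Factor
  e₁ = [] , [ false ] , [ true ]
  e₂ = [ false ] , [ true ] , []
  ¬closed-01 : ¬ Closed′ (false ∷ true ∷ [])
  ¬closed-01 c with () ← closed-pair c
  fwd : ∀ f → f ≡ e₁ ⊎ f ≡ e₂ ⊎ ⊥ → MaxClosed (false ∷ true ∷ []) f
  fwd _ (inj₁ refl) = maxClosed refl (single _) LeftMaximal-[] (λ { _ _ refl → ¬closed-01 })
  fwd _ (inj₂ (inj₁ refl)) = maxClosed refl (single _)
    (λ { [] _ refl → ¬closed-01 ; (_ ∷ l) _ e _ → ∷ʳ≢[] l (sym (∷-injectiveʳ e)) }) (λ _ _ ())
  bwd : ∀ f → MaxClosed (false ∷ true ∷ []) f → f ≡ e₁ ⊎ f ≡ e₂ ⊎ ⊥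
  bwd (_ , [] , _) (maxClosed _ closed _ _) = contradiction refl (Closed′⇒≢[] closed)
  bwd ([] , _ ∷ [] , _) (maxClosed refl _ _ _) = inj₁ refl
  bwd ([] , _ ∷ _ ∷ [] , _) (maxClosed refl closed _ _) = contradiction closed ¬closed-01
  bwd (_ ∷ [] , _ ∷ [] , _) (maxClosed refl _ _ _) = inj₂ (inj₁ refl)
  bwd (_ ∷ _ ∷ l , x@(_ ∷ _) , r) (maxClosed e _ _ _) =
    contradiction (++-conicalʳ l _ (∷-injectiveʳ (∷-injectiveʳ e))) λ ()
  bwd ([] , _ ∷ _ ∷ _ ∷ _ , _) (maxClosed () _ _ _)
  bwd (_ ∷ [] , _ ∷ _ ∷ _ , _) (maxClosed () _ _ _)

-- Letter counts

zeros ones : Word → ℕ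
zeros [] = 0
zeros (true ∷ w) = zeros w
zeros (false ∷ w) = suc (zeros w)
ones [] = 0
ones (true ∷ w) = suc (ones w)
ones (false ∷ w) = ones w

zeros-φ′ : ∀ w → zeros (φ′ w) ≡ ones w
zeros-φ′ [] = refl
zeros-φ′ (true ∷ w) = cong suc (zeros-φ′ w)
zeros-φ′ (false ∷ w) = zeros-φ′ w

ones-φ′ : ∀ w → ones (φ′ w) ≡ zeros w + ones w
ones-φ′ [] = refl
ones-φ′ (true ∷ w) = trans (cong suc (ones-φ′ w)) (sym (+-suc (zeros w) (ones w)))
ones-φ′ (false ∷ w) = cong suc (ones-φ′ w)

-- The word consists of a block 10 for each 0 of w, a block 110 for each 1, and a final 1. Both
-- letters of 10 are isolated, only the 0 of 110 is, and the final 1 accounts for the `suc`.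
#isolated-ψφ′ : ∀ w → #isolated false (ψ (φ′ w)) ≡ suc (zeros w + zeros w + ones w)
#isolated-ψφ′ [] = refl
#isolated-ψφ′ (true ∷ w) = trans (cong suc (#isolated-ψφ′ w)) (cong suc (sym (+-suc (zeros w + zeros w) (ones w))))
#isolated-ψφ′ (false ∷ w) = trans (cong (λ n → 2 + n) (#isolated-ψφ′ w)) (cong (λ k → suc (suc k + ones w)) (sym (+-suc (zeros w) (zeros w))))

#isolated-ψψ : ∀ w → #isolated false (ψ (ψ w)) ≡ 3 + (zeros w + zeros w + ones w)
#isolated-ψψ w = cong (λ n → 2 + n) (#isolated-ψφ′ w)

-- The Fibonacci words

-- f_{2k+1} and f_{2k+2} read backwards are 1 ∷ τ k and 0 ∷ ψ (τ k).
τ : ℕ → Word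
τ zero = []
τ (suc k) = φ′ (ψ (τ k))

zeros-τ : ∀ k → zeros (τ (suc k)) ≡ suc (zeros (τ k) + ones (τ k))
zeros-τ k = trans (zeros-φ′ (ψ (τ k))) (cong suc (ones-φ′ (τ k)))

ones-τ : ∀ k → ones (τ (suc k)) ≡ suc (zeros (τ k) + ones (τ k) + ones (τ k))
ones-τ k = begin
  ones (φ′ (ψ (τ k)))                             ≡⟨ ones-φ′ (ψ (τ k)) ⟩
  zeros (φ′ (τ k)) + suc (ones (φ′ (τ k)))        ≡⟨ cong₂ (λ a b → a + suc b) (zeros-φ′ (τ k)) (ones-φ′ (τ k)) ⟩
  ones (τ k) + suc (zeros (τ k) + ones (τ k))     ≡⟨ +-comm (ones (τ k)) _ ⟩
  suc (zeros (τ k) + ones (τ k) + ones (τ k))     ∎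
  where open ≡-Reasoning

-- As f_(2k+1) is 1 followed by `τ k` backwards, these are its number of 1s and its length. Linear
-- forms in the letter counts of `τ k` thus become linear forms in two consecutive Fibonacci
-- numbers.
F-even : ∀ k → F (k * 2) ≡ suc (ones (τ k))
F-odd : ∀ k → F (suc (k * 2)) ≡ suc (zeros (τ k) + ones (τ k))

F-even zero = refl
F-even (suc k) = trans (cong₂ _+_ (F-odd k) (F-even k))
  (trans (cong suc (+-suc _ _)) (cong suc (sym (ones-τ k))))

F-odd zero = refl
F-odd (suc k) = trans (cong₂ _+_ (F-even (suc k)) (F-odd k))
  (cong suc (trans (+-comm (ones (τ (suc k))) _) (cong (_+ ones (τ (suc k))) (sym (zeros-τ k)))))

cong-size : ∀ {A : Set} {P : A → Set} → m ≡ n → HasSize P m → HasSize P n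
cong-size refl h = h

#isolated-ψτ : ∀ k → #isolated false (ψ (τ (suc k))) ≡ 2 + zeros (τ k) + 3 * ones (τ k)
#isolated-ψτ k = begin
  #isolated false (ψ (φ′ (ψ (τ k))))                       ≡⟨ #isolated-ψφ′ (ψ (τ k)) ⟩
  suc (zeros (φ′ (τ k)) + zeros (φ′ (τ k)) + suc (ones (φ′ (τ k))))
    ≡⟨ cong₂ (λ a b → suc (a + a + suc b)) (zeros-φ′ (τ k)) (ones-φ′ (τ k)) ⟩
  suc (ones (τ k) + ones (τ k) + suc (zeros (τ k) + ones (τ k)))
    ≡⟨ arith (zeros (τ k)) (ones (τ k)) ⟩
  2 + zeros (τ k) + 3 * ones (τ k)                         ∎
  where
  open ≡-Reasoning
  arith : ∀ z o → suc (o + o + suc (z + o)) ≡ 2 + z + 3 * o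
  arith = solve-∀

-- By `F-odd` and `F-even` this is F_(2k+3) + F_(2k+1) - 2, one less than the odd-case formula at
-- 2k+3.
τ-count : ℕ → ℕ
τ-count k = 2 + 3 * zeros (τ k) + 4 * ones (τ k)

-- In the induction step, `ψ (ψ (τ (suc k)))` is by definition 1 followed by `τ (2 + k)`, and it
-- starts with 1010.
τ-size : ∀ k → HasSize (MaxClosed (τ (suc k))) (τ-count k)

ψτ-size : ∀ k → HasSize (MaxClosed (ψ (τ (suc k)))) (4 + 4 * zeros (τ k) + 7 * ones (τ k))
ψτ-size k = cong-size (begin
  τ-count k + #isolated false (ψ (τ (suc k)))
    ≡⟨ cong (λ n → τ-count k + n) (#isolated-ψτ k) ⟩
  τ-count k + (2 + zeros (τ k) + 3 * ones (τ k))
    ≡⟨ arith (zeros (τ k)) (ones (τ k)) ⟩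
  4 + 4 * zeros (τ k) + 7 * ones (τ k) ∎)
  (ψ-size (τ-size k))
  where
  open ≡-Reasoning
  arith : ∀ z o → 2 + 3 * z + 4 * o + (2 + z + 3 * o) ≡ 4 + 4 * z + 7 * o
  arith = solve-∀

ψψτ-size : ∀ k → HasSize (MaxClosed (ψ (ψ (τ (suc k))))) (10 + 7 * zeros (τ k) + 11 * ones (τ k))
ψψτ-size k = cong-size (begin
  4 + 4 * z + 7 * o + #isolated false (ψ (ψ (τ (suc k))))
    ≡⟨ cong (λ n → 4 + 4 * z + 7 * o + n) (#isolated-ψψ (τ (suc k))) ⟩
  4 + 4 * z + 7 * o + (3 + (zeros (τ (suc k)) + zeros (τ (suc k)) + ones (τ (suc k))))
    ≡⟨ cong₂ (λ a b → 4 + 4 * z + 7 * o + (3 + (a + a + b))) (zeros-τ k) (ones-τ k) ⟩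
  4 + 4 * z + 7 * o + (3 + (suc (z + o) + suc (z + o) + suc (z + o + o)))
    ≡⟨ arith z o ⟩
  10 + 7 * z + 11 * o ∎)
  (ψ-size (ψτ-size k))
  where
  open ≡-Reasoning
  z = zeros (τ k)
  o = ones (τ k)
  arith : ∀ z o → 4 + 4 * z + 7 * o + (3 + (suc (z + o) + suc (z + o) + suc (z + o + o))) ≡ 10 + 7 * z + 11 * o
  arith = solve-∀

τ-size zero = 01-size
τ-size (suc k) = cong-size (begin
  9 + 7 * z + 11 * o
    ≡⟨ arith z o ⟩
  2 + 3 * suc (z + o) + 4 * suc (z + o + o)
    ≡⟨ cong₂ (λ a b → 2 + 3 * a + 4 * b) (zeros-τ k) (ones-τ k) ⟨
  τ-count (suc k) ∎)
  (1010-size (No00-tail (No00-ψ (ψ (τ (suc k))))) (ψψτ-size k))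
  where
  open ≡-Reasoning
  z = zeros (τ k)
  o = ones (τ k)
  arith : ∀ z o → 9 + 7 * z + 11 * o ≡ 2 + 3 * suc (z + o) + 4 * suc (z + o + o)
  arith = solve-∀

-- Applying ψ to 1 followed by `τ (2 + k)` gives 10 followed by `ψ (τ (2 + k))`. The word is
-- therefore a triple ψ-image without its first 1, and that image starts with 1011.
0ψτ-size : ∀ k → HasSize (MaxClosed (false ∷ ψ (τ (2 + k)))) (16 + 11 * zeros (τ k) + 18 * ones (τ k))
0ψτ-size k = 1011-size (No00-tail (No00-ψ (ψ (ψ (τ (suc k)))))) (cong-size (begin
  10 + 7 * z + 11 * o + #isolated false (ψ (ψ (ψ (τ (suc k)))))
    ≡⟨ cong (λ n → 10 + 7 * z + 11 * o + n) (#isolated-ψψ (ψ (τ (suc k)))) ⟩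
  10 + 7 * z + 11 * o + (3 + (zeros (φ′ τ′) + zeros (φ′ τ′) + suc (ones (φ′ τ′))))
    ≡⟨ cong₂ (λ a b → 10 + 7 * z + 11 * o + (3 + (a + a + suc b))) (zeros-φ′ τ′) (ones-φ′ τ′) ⟩
  10 + 7 * z + 11 * o + (3 + (ones τ′ + ones τ′ + suc (zeros τ′ + ones τ′)))
    ≡⟨ cong₂ (λ a b → 10 + 7 * z + 11 * o + (3 + (b + b + suc (a + b)))) (zeros-τ k) (ones-τ k) ⟩
  10 + 7 * z + 11 * o + (3 + (suc (z + o + o) + suc (z + o + o) + suc (suc (z + o) + suc (z + o + o))))
    ≡⟨ arith z o ⟩
  18 + 11 * z + 18 * o ∎)
  (ψ-size (ψψτ-size k)))
  where
  open ≡-Reasoning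
  τ′ = τ (suc k)
  z = zeros (τ k)
  o = ones (τ k)
  arith : ∀ z o → 10 + 7 * z + 11 * o + (3 + (suc (z + o + o) + suc (z + o + o) + suc (suc (z + o) + suc (z + o + o))))
                  ≡ 18 + 11 * z + 18 * o
  arith = solve-∀

-- Fibonacci words read backwards

reverse-φ : ∀ w → reverse (φ w) ≡ φ′ (reverse w)
reverse-φ w = begin
  reverse (φ w)                        ≡⟨ cong (reverse ∘ φ) (reverse-involutive w) ⟨
  reverse (φ (reverse (reverse w)))    ≡⟨ cong reverse (reverse-φ′ (reverse w)) ⟨
  reverse (reverse (φ′ (reverse w)))   ≡⟨ reverse-involutive _ ⟩
  φ′ (reverse w)                       ∎
  where open ≡-Reasoning

fibWord-suc : ∀ n → fibWord (suc n) ≡ φ (fibWord n)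
fibWord-suc zero = refl
fibWord-suc (suc zero) = refl
fibWord-suc (suc (suc n)) = trans (cong₂ _++_ (fibWord-suc (suc n)) (fibWord-suc n))
  (sym (φ-++ (fibWord (suc n)) (fibWord n)))

reverse-fibWord-suc : ∀ n → reverse (fibWord (suc n)) ≡ φ′ (reverse (fibWord n))
reverse-fibWord-suc n = trans (cong reverse (fibWord-suc n)) (reverse-φ (fibWord n))

reverse-fibWord-odd : ∀ k → reverse (fibWord (1 + k * 2)) ≡ true ∷ τ k
reverse-fibWord-even : ∀ k → reverse (fibWord (2 + k * 2)) ≡ false ∷ ψ (τ k)

reverse-fibWord-odd zero = refl
reverse-fibWord-odd (suc k) = trans (reverse-fibWord-suc (2 + k * 2)) (cong φ′ (reverse-fibWord-even k))

reverse-fibWord-even k = trans (reverse-fibWord-suc (1 + k * 2)) (cong φ′ (reverse-fibWord-odd k))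

HasSize-reverse : HasSize (MaxClosed (reverse w)) n → HasSize (MaxClosed w) n
HasSize-reverse {w} = HasSize-map reverseFactor
  (λ { {f} {g} _ _ e → trans (sym (involutive f)) (trans (cong reverseFactor e) (involutive g)) })
  (λ h → subst (λ v → MaxClosed v _) (reverse-involutive w) (MaxClosed-reverse h))
  (λ {f} h → reverseFactor f , MaxClosed-reverse h , involutive f)
  where
  involutive : ∀ f → reverseFactor (reverseFactor f) ≡ f
  involutive (l , x , r) = cong₂ _,_ (reverse-involutive l) (cong₂ _,_ (reverse-involutive x) (reverse-involutive r))

-- From factorizations to positions

length-≡0 : ∀ {A : Set} (xs : List A) → length xs ≡ 0 → xs ≡ []
length-≡0 [] _ = refl

length-≢[] : x ≢ [] → 1 ≤ length x
length-≢[] {[]} x≢[] = contradiction refl x≢[]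
length-≢[] {_ ∷ _} _ = s≤s z≤n

drop-length-++ : ∀ (a b : Word) → drop (length a) (a ++ b) ≡ b
drop-length-++ [] b = refl
drop-length-++ (_ ∷ a) b = drop-length-++ a b

take-length-++ : ∀ (a b : Word) → take (length a) (a ++ b) ≡ a
take-length-++ [] b = refl
take-length-++ (c ∷ a) b = cong (c ∷_) (take-length-++ a b)

closed⇒closed′ : Closed x → Closed′ x
closed⇒closed′ {[]} (inj₁ ())
closed⇒closed′ {c ∷ []} (inj₁ _) = single c
closed⇒closed′ {_ ∷ _ ∷ _} (inj₁ ())
closed⇒closed′ {x} (inj₂ (_ , u , (u≢[] , u<x , (b , p) , (a , q)) , only)) =
  return (u≢[] , (b , b≢[] b p , p) , (a , a≢[] a q , q) , only′)
  where
  b≢[] : ∀ b → u ++ b ≡ x → b ≢ []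
  b≢[] b p refl = <-irrefl (cong length (trans (sym (++-identityʳ u)) p)) u<x
  a≢[] : ∀ a → a ++ u ≡ x → a ≢ []
  a≢[] a q refl = <-irrefl (cong length q) u<x
  only′ : ∀ c d → c ++ u ++ d ≡ x → c ≡ [] ⊎ d ≡ []
  only′ c d refl with only (length c) (d , sym (drop-length-++ c _))
  ... | inj₁ c≡0 = inj₁ (length-≡0 c c≡0)
  ... | inj₂ c≡ = inj₂ (length-≡0 d (+-cancelˡ-≡ (length c) _ _ (begin
          length c + length d                                   ≡⟨ m+n∸m≡n (length u) _ ⟨
          length u + (length c + length d) ∸ length u           ≡⟨ cong (_∸ length u) (exchange (length u) (length c) (length d)) ⟩
          length c + (length u + length d) ∸ length u           ≡⟨ cong (λ k → length c + k ∸ length u) (length-++ u) ⟨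
          length c + length (u ++ d) ∸ length u                 ≡⟨ cong (_∸ length u) (length-++ c) ⟨
          length (c ++ u ++ d) ∸ length u                       ≡⟨ c≡ ⟨
          length c                                              ≡⟨ +-identityʳ _ ⟨
          length c + 0                                          ∎)))
    where
    open ≡-Reasoning
    exchange : ∀ a b c → a + (b + c) ≡ b + (a + c)
    exchange = solve-∀

take-≡[] : ∀ k → x ≢ [] → take k x ≡ [] → k ≡ 0
take-≡[] zero _ _ = refl
take-≡[] {[]} (suc k) x≢[] _ = contradiction refl x≢[]
take-≡[] {_ ∷ _} (suc k) _ ()

closed′⇒closed : Closed′ x → Closed x
closed′⇒closed (single c) = inj₁ refl
closed′⇒closed (return {u} {x} ret@(u≢[] , (b , b≢[] , p) , (a , a≢[] , q) , only)) =
  inj₂ (2≤x p , u , (u≢[] , u<x p , (b , p) , (a , q)) , only′)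
  where
  x≢[] = Closed′⇒≢[] (return ret)
  2≤x : u ++ b ≡ x → 2 ≤ length x
  2≤x refl = subst (2 ≤_) (sym (length-++ u)) (+-mono-≤ (length-≢[] u≢[]) (length-≢[] b≢[]))
  u<x : u ++ b ≡ x → length u < length x
  u<x refl = subst (length u <_) (sym (length-++ u)) (m<m+n (length u) (length-≢[] b≢[]))
  only′ : ∀ k → OccursAt u x k → k ≡ 0 ⊎ k ≡ length x ∸ length u
  only′ k (v , e) with only (take k x) v (trans (cong (take k x ++_) e) (take++drop≡id k x))
  ... | inj₁ t≡[] = inj₁ (take-≡[] k x≢[] t≡[])
  ... | inj₂ refl = inj₂ (sym (trans (cong (length x ∸_) |u|≡) (m∸[m∸n]≡n k≤x)))
    where
    |u|≡ : length u ≡ length x ∸ k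
    |u|≡ = trans (cong length (trans (sym (++-identityʳ u)) e)) (length-drop k x)
    -- Beyond the end of x, `drop k x` is empty and u would be too. The bound makes the truncated
    -- differences invertible.
    k≤x : k ≤ length x
    k≤x with k ≤? length x
    ... | yes k≤x = k≤x
    ... | no k≰x = contradiction (length-≡0 u (trans |u|≡ (m≤n⇒m∸n≡0 (<⇒≤ (≰⇒> k≰x))))) u≢[]

sub-factor : ∀ l x {r i j} → x ≢ [] → i ≡ suc (length l) → j ≡ length l + length x →
             sub (l ++ x ++ r) i j ≡ x
sub-factor l [] x≢[] _ _ = contradiction refl x≢[]
sub-factor l x@(_ ∷ x′) {r} _ refl refl = begin
  take (suc (length l + length x ∸ suc (length l))) (drop (length l) (l ++ x ++ r))
    ≡⟨ cong₂ take (cong suc (trans (cong (_∸ suc (length l)) (+-suc (length l) (length x′))) (m+n∸m≡n (length l) _)))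
                  (drop-length-++ l _) ⟩
  take (length x) (x ++ r) ≡⟨ take-length-++ x r ⟩
  x ∎
  where open ≡-Reasoning

length-++₃ : ∀ (l x r : Word) → length (l ++ x ++ r) ≡ length l + length x + length r
length-++₃ l x r = trans (length-++ l) (trans (cong (λ n → length l + n) (length-++ x)) (sym (+-assoc (length l) _ _)))

length-∷ʳ : ∀ c (l : Word) → length (l ∷ʳ c) ≡ suc (length l)
length-∷ʳ c l = trans (length-++ l) (+-comm (length l) 1)

sub-left : ∀ l c x r → sub ((l ∷ʳ c) ++ x ++ r) (length (l ∷ʳ c)) (length (l ∷ʳ c) + length x) ≡ c ∷ x
sub-left l c x r = trans
  (cong (λ v → sub v (length (l ∷ʳ c)) (length (l ∷ʳ c) + length x)) (++-assoc l [ c ] (x ++ r)))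
  (sub-factor l (c ∷ x) (λ ()) (length-∷ʳ c l)
    (trans (cong (_+ length x) (length-∷ʳ c l)) (sym (+-suc (length l) (length x)))))

sub-right : ∀ l x c r → sub (l ++ x ++ c ∷ r) (suc (length l)) (suc (length l + length x)) ≡ x ∷ʳ c
sub-right l x c r = trans
  (cong (λ v → sub v (suc (length l)) (suc (length l + length x))) (cong (l ++_) (sym (++-assoc x [ c ] r))))
  (sub-factor l (x ∷ʳ c) (∷ʳ≢[] x) refl
    (sym (trans (cong (λ n → length l + n) (length-∷ʳ c x)) (+-suc (length l) (length x)))))

position : Factor → ℕ × ℕ
position (l , x , r) = suc (length l) , length l + length x

maxClosed⇔MCS : ∀ l x r → x ≢ [] →
  MaxClosed (l ++ x ++ r) (l , x , r) ⇔ MCS (l ++ x ++ r) (suc (length l)) (length l + length x)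
maxClosed⇔MCS l x r x≢[] = mk⇔ fwd bwd
  where
  i = suc (length l)
  j = length l + length x
  x≡ : sub (l ++ x ++ r) i j ≡ x
  x≡ = sub-factor l x x≢[] refl refl
  occ : Occ (l ++ x ++ r) i j
  occ = s≤s z≤n , m<m+n (length l) (length-≢[] x≢[])
    , subst (j ≤_) (sym (length-++₃ l x r)) (m≤m+n j (length r))
  fwd : MaxClosed (l ++ x ++ r) (l , x , r) → MCS (l ++ x ++ r) i j
  fwd (maxClosed _ closed left right) = (occ , closed-x , left′ l left) , (occ , closed-x , right′ r right)
    where
    closed-x : Closed (sub (l ++ x ++ r) i j)
    closed-x = subst Closed (sym x≡) (closed′⇒closed closed)
    left′ : ∀ l → LeftMaximal l x → suc (length l) ≡ 1 ⊎
            ¬ Closed (sub (l ++ x ++ r) (length l) (length l + length x))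
    left′ l left with initLast l
    ... | [] = inj₁ refl
    ... | l′ ∷ʳ′ c = inj₂ (left l′ c refl ∘ closed⇒closed′ ∘ subst Closed (sub-left l′ c x r))
    right′ : ∀ r → RightMaximal x r → j ≡ length (l ++ x ++ r) ⊎ ¬ Closed (sub (l ++ x ++ r) i (suc j))
    right′ [] right = inj₁ (sym (trans (length-++₃ l x []) (+-identityʳ j)))
    right′ (c ∷ r) right = inj₂ (right c r refl ∘ closed⇒closed′ ∘ subst Closed (sub-right l x c r))
  bwd : MCS (l ++ x ++ r) i j → MaxClosed (l ++ x ++ r) (l , x , r)
  bwd ((_ , closed , left) , (_ , _ , right)) =
    maxClosed refl (closed⇒closed′ (subst Closed x≡ closed)) (left′ l left) (right′ r right)
    where
    left′ : ∀ l → suc (length l) ≡ 1 ⊎ ¬ Closed (sub (l ++ x ++ r) (length l) (length l + length x)) →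
            LeftMaximal l x
    left′ l (inj₁ e) l′ c refl _ = ∷ʳ≢[] l′ (length-≡0 _ (suc-injective e))
    left′ l (inj₂ ¬closed) l′ c refl closed =
      ¬closed (subst Closed (sym (sub-left l′ c x r)) (closed′⇒closed closed))
    right′ : ∀ r → j ≡ length (l ++ x ++ r) ⊎ ¬ Closed (sub (l ++ x ++ r) i (suc j)) → RightMaximal x r
    right′ _ (inj₁ e) c r refl _ =
      1+n≢0 (+-cancelˡ-≡ j _ _ (sym (trans (+-identityʳ j) (trans e (length-++₃ l x (c ∷ r))))))
    right′ _ (inj₂ ¬closed) c r refl closed =
      ¬closed (subst Closed (sym (sub-right l x c r)) (closed′⇒closed closed))

split : ∀ k (w : Word) → k ≤ length w → ∃₂ λ a b → a ++ b ≡ w × length a ≡ k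
split zero w _ = [] , w , refl , refl
split (suc k) (c ∷ w) (s≤s k≤) with a , b , refl , refl ← split k w k≤ = c ∷ a , b , refl , refl

factor-at : ∀ {w i j} → Occ w i j → ∃₂ λ l x → ∃ λ r →
            l ++ x ++ r ≡ w × x ≢ [] × i ≡ suc (length l) × j ≡ length l + length x
factor-at {w} {suc i} {suc j} (_ , s≤s i≤j , j≤w)
  with a , r , refl , a≡ ← split (suc j) w j≤w
  with l , x , refl , refl ← split i a (≤-trans (m≤n⇒m≤1+n i≤j) (≤-reflexive (sym a≡))) =
  l , x , r , sym (++-assoc l x r) , x≢[] , refl , j≡
  where
  j≡ : suc j ≡ length l + length x
  j≡ = trans (sym a≡) (length-++ l)
  x≢[] : x ≢ []
  x≢[] refl = <-irrefl refl (≤-trans (≤-reflexive j≡) (≤-trans (≤-reflexive (+-identityʳ _)) i≤j))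

++-injective : ∀ (a a′ : Word) {b b′} → length a ≡ length a′ → a ++ b ≡ a′ ++ b′ → a ≡ a′ × b ≡ b′
++-injective [] [] _ e = refl , e
++-injective (c ∷ a) (c′ ∷ a′) l e with p , q ← ++-injective a a′ (suc-injective l) (∷-injectiveʳ e) =
  cong₂ _∷_ (∷-injectiveˡ e) p , q

HasSize-MCS : HasSize (MaxClosed w) n → HasSize (uncurry (MCS w)) n
HasSize-MCS {w} = HasSize-map position inj fwd surj
  where
  inj : ∀ {f g} → MaxClosed w f → MaxClosed w g → position f ≡ position g → f ≡ g
  inj {l , x , r} {l′ , x′ , r′} (maxClosed e _ _ _) (maxClosed e′ _ _ _) p
    with refl , q ← ++-injective l l′ (suc-injective (cong proj₁ p)) (trans e (sym e′))
    with refl , refl ← ++-injective x x′ (+-cancelˡ-≡ (length l) _ _ (cong proj₂ p)) q = refl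
  fwd : ∀ {f} → MaxClosed w f → uncurry (MCS w) (position f)
  fwd h@(maxClosed refl closed _ _) = to (maxClosed⇔MCS _ _ _ (Closed′⇒≢[] closed)) h
  surj : ∀ {p} → uncurry (MCS w) p → ∃ λ f → MaxClosed w f × position f ≡ p
  surj {i , j} h@((occ , _) , _) with l , x , r , refl , x≢[] , refl , refl ← factor-at {w} occ =
    (l , x , r) , from (maxClosed⇔MCS l x r x≢[]) h , refl

MCS-size : reverse w ≡ x → HasSize (MaxClosed x) n → HasSize (uncurry (MCS w)) n
MCS-size refl h = HasSize-MCS (HasSize-reverse h)

fibWord-odd-size : ∀ k → ∃ λ m → HasSize (uncurry (MCS (fibWord (5 + k * 2)))) m × 1 + m ≡ F (5 + k * 2) + F (3 + k * 2)
fibWord-odd-size k = _ , MCS-size (reverse-fibWord-odd (2 + k)) (ψψτ-size k) , (begin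
  11 + 7 * z + 11 * o ≡⟨ arith z o ⟩
  -- From p = F_(2k+1) and q = F_(2k), the values s, t, u are the next three Fibonacci numbers.
  _ ≡⟨ cong₂ (λ p q → let s = p + q ; t = s + p ; u = t + s in u + t + t) (F-odd k) (F-even k) ⟨
  F (5 + k * 2) + F (3 + k * 2) ∎)
  where
  open ≡-Reasoning
  z = zeros (τ k)
  o = ones (τ k)
  arith : ∀ z o → 11 + 7 * z + 11 * o ≡
    (let p = suc (z + o) ; q = suc o ; s = p + q ; t = s + p ; u = t + s in u + t + t)
  arith = solve-∀

fibWord-even-size : ∀ k → ∃ λ m → HasSize (uncurry (MCS (fibWord (6 + k * 2)))) m × 2 + m ≡ F (6 + k * 2) + F (4 + k * 2)
fibWord-even-size k = _ , MCS-size (reverse-fibWord-even (2 + k)) (0ψτ-size k) , (begin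
  18 + 11 * z + 18 * o ≡⟨ arith z o ⟩
  _ ≡⟨ cong₂ (λ p q → let s = p + q ; t = s + p ; u = t + s ; v = u + t in v + u + u) (F-odd k) (F-even k) ⟨
  F (6 + k * 2) + F (4 + k * 2) ∎)
  where
  open ≡-Reasoning
  z = zeros (τ k)
  o = ones (τ k)
  arith : ∀ z o → 18 + 11 * z + 18 * o ≡
    (let p = suc (z + o) ; q = suc o ; s = p + q ; t = s + p ; u = t + s ; v = u + t in v + u + u)
  arith = solve-∀

-- The limit

even-or-odd : ∀ n → ∃ λ k → n ≡ k * 2 ⊎ n ≡ 1 + k * 2
even-or-odd zero = 0 , inj₁ refl
even-or-odd (suc n) with even-or-odd n
... | k , inj₁ refl = k , inj₂ refl
... | k , inj₂ refl = suc k , inj₁ refl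

Correction : ℕ → ℕ → Set
Correction n c = (n % 2 ≡ 1 × c ≡ 1) ⊎ (n % 2 ≡ 0 × c ≡ 2)

record Counted (n : ℕ) : Set where
  constructor counted
  field
    {deficit count} : ℕ
    correction : Correction n deficit
    size       : HasSize (uncurry (MCS (fibWord n))) count
    total      : deficit + count ≡ F n + F (n ∸ 2)

counted-odd : ∀ k → Counted (5 + k * 2)
counted-odd k = let m , h , e = fibWord-odd-size k in counted (inj₁ ([m+kn]%n≡m%n 5 k 2 , refl)) h e

counted-even : ∀ k → Counted (6 + k * 2)
counted-even k = let m , h , e = fibWord-even-size k in counted (inj₂ ([m+kn]%n≡m%n 6 k 2 , refl)) h e

MCS-count : ∀ n → 5 ≤ n → Counted n
MCS-count n 5≤n = subst Counted (m+[n∸m]≡n 5≤n) (by-parity (even-or-odd (n ∸ 5)))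
  where
  by-parity : ∀ {t} → (∃ λ k → t ≡ k * 2 ⊎ t ≡ 1 + k * 2) → Counted (5 + t)
  by-parity (k , inj₁ refl) = counted-odd k
  by-parity (k , inj₂ refl) = counted-even k

correction-bounds : ∀ n c → Correction n c → 1 ≤ c × c ≤ 2
correction-bounds n c (inj₁ (_ , refl)) = s≤s z≤n , s≤s z≤n
correction-bounds n c (inj₂ (_ , refl)) = s≤s z≤n , ≤-refl

length-count : ∀ n → 5 ≤ n → (L : List (ℕ × ℕ)) → Unique L →
  (∀ i j → ((i , j) ∈ L) ⇔ MCS (fibWord n) i j) →
  ∃ λ c → (1 ≤ c × c ≤ 2) × c + length L ≡ F n + F (n ∸ 2)
length-count n 5≤n L u mem with counted {c} corr h e ← MCS-count n 5≤n =
  c , correction-bounds n c corr , trans (cong (λ k → c + k) (HasSize-unique (L , u , refl , uncurry mem) h)) e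

-- Fibonacci numbers and the square root of 5

F-positive : ∀ n → 1 ≤ F n
F-positive zero = ≤-refl
F-positive (suc zero) = ≤-refl
F-positive (suc (suc n)) = ≤-trans (F-positive n) (m≤n+m (F n) (F (suc n)))

n≤F : ∀ n → n ≤ F n
n≤F zero = z≤n
n≤F (suc zero) = ≤-refl
n≤F (suc (suc n)) = begin
  2 + n            ≡⟨ +-comm 1 (suc n) ⟩
  suc n + 1        ≤⟨ +-mono-≤ (n≤F (suc n)) (F-positive n) ⟩
  F (suc n) + F n  ∎
  where open ≤-Reasoning

-- The form q² - qp - p² changes sign under (q, p) ↦ (q + p, q), so it alternates between -1 and 1.
cassini : ∀ n → let q = F (suc n) ; p = F n in
  q * q ≡ q * p + p * p + 1 ⊎ q * q + 1 ≡ q * p + p * p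
cassini zero = inj₂ refl
cassini (suc n) with cassini n
... | inj₁ e = inj₂ (begin
  (q + p) * (q + p) + 1                       ≡⟨ expand q p ⟩
  q * q + q * p + (q * p + p * p + 1)         ≡⟨ cong (λ k → q * q + q * p + k) e ⟨
  q * q + q * p + q * q                       ≡⟨ collect q p ⟩
  (q + p) * q + q * q                         ∎)
  where
  open ≡-Reasoning
  q = F (suc n)
  p = F n
  expand : ∀ q p → (q + p) * (q + p) + 1 ≡ q * q + q * p + (q * p + p * p + 1)
  expand = solve-∀
  collect : ∀ q p → q * q + q * p + q * q ≡ (q + p) * q + q * q
  collect = solve-∀
... | inj₂ e = inj₁ (begin
  (q + p) * (q + p)                           ≡⟨ expand q p ⟩
  q * q + q * p + (q * p + p * p)             ≡⟨ cong (λ k → q * q + q * p + k) e ⟨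
  q * q + q * p + (q * q + 1)                 ≡⟨ collect q p ⟩
  (q + p) * q + q * q + 1                     ∎)
  where
  open ≡-Reasoning
  q = F (suc n)
  p = F n
  expand : ∀ q p → (q + p) * (q + p) ≡ q * q + q * p + (q * p + p * p)
  expand = solve-∀
  collect : ∀ q p → q * q + q * p + (q * q + 1) ≡ (q + p) * q + q * q + 1
  collect = solve-∀

-- S n = 3 F (2 + n) − 2 F n without subtraction.
S : ℕ → ℕ
S n = 3 * F (suc n) + F n

-- For q, p as in `cassini`, (3q + p)² - 5(q + p)² = 4(q² - qp - p²), which is ±4. `S n` is the
-- Lucas number belonging to F_(n+2).
S²-upper : ∀ n → S n * S n ≤ 5 * (F (2 + n) * F (2 + n)) + 4
S²-lower : ∀ n → 5 * (F (2 + n) * F (2 + n)) ≤ S n * S n + 4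

private
  S²-expand : ∀ q p → (3 * q + p) * (3 * q + p) ≡ 5 * (q * q) + 6 * (q * p) + p * p + 4 * (q * q)
  S²-expand = solve-∀
  5F²-expand : ∀ q p → 5 * ((q + p) * (q + p)) ≡ 5 * (q * q) + 6 * (q * p) + p * p + 4 * (q * p + p * p)
  5F²-expand = solve-∀

S²-upper n = begin
  S n * S n                                          ≡⟨ S²-expand q p ⟩
  t + 4 * (q * q)                                    ≤⟨ +-monoʳ-≤ t (*-monoʳ-≤ 4 q²≤) ⟩
  t + 4 * (q * p + p * p + 1)                        ≡⟨ collect q p t ⟩
  t + 4 * (q * p + p * p) + 4                        ≡⟨ cong (_+ 4) (5F²-expand q p) ⟨
  5 * ((q + p) * (q + p)) + 4                        ∎
  where
  open ≤-Reasoning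
  q = F (suc n)
  p = F n
  t = 5 * (q * q) + 6 * (q * p) + p * p
  q²≤ : q * q ≤ q * p + p * p + 1
  q²≤ with cassini n
  ... | inj₁ e = ≤-reflexive e
  ... | inj₂ e = ≤-trans (m≤m+n (q * q) 1) (≤-trans (≤-reflexive e) (m≤m+n _ 1))
  collect : ∀ q p t → t + 4 * (q * p + p * p + 1) ≡ t + 4 * (q * p + p * p) + 4
  collect = solve-∀

S²-lower n = begin
  5 * ((q + p) * (q + p))                            ≡⟨ 5F²-expand q p ⟩
  t + 4 * (q * p + p * p)                            ≤⟨ +-monoʳ-≤ t (*-monoʳ-≤ 4 ≤q²) ⟩
  t + 4 * (q * q + 1)                                ≡⟨ collect q t ⟩
  t + 4 * (q * q) + 4                                ≡⟨ cong (_+ 4) (S²-expand q p) ⟨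
  S n * S n + 4                                      ∎
  where
  open ≤-Reasoning
  q = F (suc n)
  p = F n
  t = 5 * (q * q) + 6 * (q * p) + p * p
  ≤q² : q * p + p * p ≤ q * q + 1
  ≤q² with cassini n
  ... | inj₂ e = ≤-reflexive (sym e)
  ... | inj₁ e = ≤-trans (m≤m+n _ 1) (≤-trans (≤-reflexive (sym e)) (m≤m+n _ 1))
  collect : ∀ q t → t + 4 * (q * q + 1) ≡ t + 4 * (q * q) + 4
  collect = solve-∀

S≤3F : ∀ n → S n ≤ 3 * F (2 + n)
S≤3F n = begin
  3 * F (suc n) + F n          ≤⟨ +-monoʳ-≤ (3 * F (suc n)) (m≤n*m (F n) 3) ⟩
  3 * F (suc n) + 3 * F n      ≡⟨ *-distribˡ-+ 3 (F (suc n)) (F n) ⟨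
  3 * F (2 + n)                ∎
  where open ≤-Reasoning

square-* : ∀ x y → (x * y) * (x * y) ≡ (x * x) * (y * y)
square-* = solve-∀

-- For integers, 5b² < d² leaves a gap of at least p² after multiplication by p². The error is (s +
-- 4)² ≤ 5p² + 24p + 20 ≤ 5p² + 44p, so the contrary would give p² ≤ 44b²p.
lower-ℕ : ∀ {p s c b d} → 1 ≤ p → s * s ≤ 5 * (p * p) + 4 → s ≤ 3 * p → c ≤ 2 →
          5 * (b * b) < d * d → 44 * (b * b) < p → (s + 2 * c) * b < d * p
lower-ℕ {p} {s} {c} {b} {d} 1≤p s² s≤3p c≤2 5b²<d² 44b²<p = ≰⇒> λ dp≤ → <⇒≱ 44b²<p
  (*-cancelʳ-≤ p (44 * (b * b)) p {{>-nonZero 1≤p}} (+-cancelˡ-≤ (5 * (b * b) * (p * p)) _ _ (begin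
    5 * (b * b) * (p * p) + p * p                        ≡⟨ +-comm _ (p * p) ⟩
    suc (5 * (b * b)) * (p * p)                          ≤⟨ *-monoˡ-≤ (p * p) 5b²<d² ⟩
    (d * d) * (p * p)                                    ≡⟨ square-* d p ⟨
    (d * p) * (d * p)                                    ≤⟨ *-mono-≤ dp≤ dp≤ ⟩
    ((s + 2 * c) * b) * ((s + 2 * c) * b)                ≡⟨ square-* (s + 2 * c) b ⟩
    ((s + 2 * c) * (s + 2 * c)) * (b * b)                ≤⟨ *-monoˡ-≤ (b * b) (*-mono-≤ s+2c≤ s+2c≤) ⟩
    ((s + 4) * (s + 4)) * (b * b)                        ≡⟨ cong (_* (b * b)) (expand s) ⟩
    (s * s + (8 * s + 16)) * (b * b)
      ≤⟨ *-monoˡ-≤ (b * b) (+-mono-≤ s² (+-mono-≤ (*-monoʳ-≤ 8 s≤3p) ≤-refl)) ⟩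
    (5 * (p * p) + 4 + (8 * (3 * p) + 16)) * (b * b)     ≡⟨ cong (_* (b * b)) (collect p) ⟩
    (5 * (p * p) + (24 * p + 20 * 1)) * (b * b)
      ≤⟨ *-monoˡ-≤ (b * b) (+-monoʳ-≤ (5 * (p * p)) (+-monoʳ-≤ (24 * p) (*-monoʳ-≤ 20 1≤p))) ⟩
    (5 * (p * p) + (24 * p + 20 * p)) * (b * b)          ≡⟨ distribute p (b * b) ⟩
    5 * (b * b) * (p * p) + 44 * (b * b) * p             ∎)))
  where
  open ≤-Reasoning
  s+2c≤ : s + 2 * c ≤ s + 4
  s+2c≤ = +-monoʳ-≤ s (*-monoʳ-≤ 2 c≤2)
  expand : ∀ s → (s + 4) * (s + 4) ≡ s * s + (8 * s + 16)
  expand = solve-∀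
  collect : ∀ p → 5 * (p * p) + 4 + (8 * (3 * p) + 16) ≡ 5 * (p * p) + (24 * p + 20 * 1)
  collect = solve-∀
  distribute : ∀ p q → (5 * (p * p) + (24 * p + 20 * p)) * q ≡ 5 * q * (p * p) + 44 * q * p
  distribute = solve-∀

-- The correction c ≥ 1 outweighs the Cassini error: (s + 2c)² ≥ s² + 4 ≥ 5p² for every p, and no
-- threshold depending on b arises.
upper-ℕ : ∀ {p s c b d} → 1 ≤ p → 5 * (p * p) ≤ s * s + 4 → 1 ≤ c →
          d * d < 5 * (b * b) → d * p < (s + 2 * c) * b
upper-ℕ {p} {s} {c} {b} {d} 1≤p s² 1≤c d²<5b² = ≰⇒> λ ≤dp → <⇒≱ (*-mono-≤ 1≤p 1≤p)
  (+-cancelʳ-≤ (d * d * (p * p)) _ _ (begin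
    p * p + d * d * (p * p)                         ≤⟨ *-monoˡ-≤ (p * p) d²<5b² ⟩
    5 * (b * b) * (p * p)                           ≡⟨ swap (b * b) (p * p) ⟩
    5 * (p * p) * (b * b)                           ≤⟨ *-monoˡ-≤ (b * b) (≤-trans s² (m≤n+m _ (4 * s))) ⟩
    (4 * s + (s * s + 4)) * (b * b)                 ≡⟨ cong (_* (b * b)) (collect s) ⟩
    ((s + 2 * 1) * (s + 2 * 1)) * (b * b)           ≤⟨ *-monoˡ-≤ (b * b) (*-mono-≤ s+2≤ s+2≤) ⟩
    ((s + 2 * c) * (s + 2 * c)) * (b * b)           ≡⟨ square-* (s + 2 * c) b ⟨
    ((s + 2 * c) * b) * ((s + 2 * c) * b)           ≤⟨ *-mono-≤ ≤dp ≤dp ⟩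
    (d * p) * (d * p)                               ≡⟨ square-* d p ⟩
    0 + d * d * (p * p)                             ∎))
  where
  open ≤-Reasoning
  s+2≤ : s + 2 * 1 ≤ s + 2 * c
  s+2≤ = +-monoʳ-≤ s (*-monoʳ-≤ 2 1≤c)
  swap : ∀ x y → 5 * x * y ≡ 5 * y * x
  swap = solve-∀
  collect : ∀ s → 4 * s + (s * s + 4) ≡ (s + 2 * 1) * (s + 2 * 1)
  collect = solve-∀

5F≡ : ∀ n {c m} → c + m ≡ F (2 + n) + F n → 5 * F (2 + n) ≡ 2 * m + (S n + 2 * c)
5F≡ n {c} {m} e = begin
  5 * (q + p)                          ≡⟨ regroup q p ⟩
  2 * (q + p + p) + (3 * q + p)        ≡⟨ cong (λ k → 2 * k + S n) e ⟨
  2 * (c + m) + S n                    ≡⟨ collect c m (S n) ⟩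
  2 * m + (S n + 2 * c)                ∎
  where
  open ≡-Reasoning
  q = F (suc n)
  p = F n
  regroup : ∀ q p → 5 * (q + p) ≡ 2 * (q + p + p) + (3 * q + p)
  regroup = solve-∀
  collect : ∀ c m s → 2 * (c + m) + s ≡ 2 * m + (s + 2 * c)
  collect = solve-∀

-- Comparison with a rational number a/b

pos-5F : ∀ {p m s} → 5 * p ≡ 2 * m + s → (+ 5) ℤ.* + p ≡ (+ 2) ℤ.* + m ℤ.+ + s
pos-5F {p} {m} {s} e = begin
  (+ 5) ℤ.* + p             ≡⟨ ℤ.pos-* 5 p ⟨
  + (5 * p)                 ≡⟨ cong +_ e ⟩
  + (2 * m) ℤ.+ + s         ≡⟨ cong (ℤ._+ + s) (ℤ.pos-* 2 m) ⟩
  (+ 2) ℤ.* + m ℤ.+ + s     ∎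
  where open ≡-Reasoning

module _ (a : ℤ) (b : ℕ) where
  private
    D : ℤ
    D = (+ 5) ℤ.* (+ b) ℤ.- (+ 2) ℤ.* a

  -- Both sides are 5pb. Hence 2(mb - ap) = Dp - sb, and comparing m/p with a/b amounts to comparing
  -- D/b with s/p, which approximates √5 for s = S + 2c.
  balance : ∀ {p m s} → 5 * p ≡ 2 * m + s →
            (+ 2) ℤ.* (a ℤ.* + p) ℤ.+ D ℤ.* + p ≡ (+ 2) ℤ.* (+ m ℤ.* + b) ℤ.+ + s ℤ.* + b
  balance {p} {m} {s} e = begin
    (+ 2) ℤ.* (a ℤ.* + p) ℤ.+ D ℤ.* + p               ≡⟨ left a (+ b) (+ p) ⟩
    (+ 5) ℤ.* + p ℤ.* + b                             ≡⟨ cong (ℤ._* + b) (pos-5F {p} {m} {s} e) ⟩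
    ((+ 2) ℤ.* + m ℤ.+ + s) ℤ.* + b                   ≡⟨ right (+ m) (+ s) (+ b) ⟩
    (+ 2) ℤ.* (+ m ℤ.* + b) ℤ.+ + s ℤ.* + b           ∎
    where
    open ≡-Reasoning
    left : ∀ a b p → (+ 2) ℤ.* (a ℤ.* p) ℤ.+ ((+ 5) ℤ.* b ℤ.- (+ 2) ℤ.* a) ℤ.* p ≡ (+ 5) ℤ.* p ℤ.* b
    left = ℤ.solve-∀
    right : ∀ m s b → ((+ 2) ℤ.* m ℤ.+ s) ℤ.* b ≡ (+ 2) ℤ.* (m ℤ.* b) ℤ.+ s ℤ.* b
    right = ℤ.solve-∀

  lower-ℤ : ∀ {p m s} → 5 * p ≡ 2 * m + s → + s ℤ.* + b ℤ.< D ℤ.* + p → a ℤ.* + p ℤ.< + m ℤ.* + b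
  lower-ℤ {p} {m} {s} e sb<Dp = ℤ.*-cancelˡ-<-nonNeg (+ 2) (ℤ.≰⇒> λ le → ℤ.<-irrefl (sym (balance {p} {m} {s} e))
    (ℤ.+-mono-≤-< le sb<Dp))

  upper-ℤ : ∀ {p m s} → 5 * p ≡ 2 * m + s → D ℤ.* + p ℤ.< + s ℤ.* + b → + m ℤ.* + b ℤ.< a ℤ.* + p
  upper-ℤ {p} {m} {s} e Dp<sb = ℤ.*-cancelˡ-<-nonNeg (+ 2) (ℤ.≰⇒> λ le → ℤ.<-irrefl (balance {p} {m} {s} e)
    (ℤ.+-mono-≤-< le Dp<sb))

pos-5* : ∀ b → (+ 5) ℤ.* ((+ b) ℤ.* (+ b)) ≡ + (5 * (b * b))
pos-5* b = trans (cong ((+ 5) ℤ.*_) (sym (ℤ.pos-* b b))) (sym (ℤ.pos-* 5 (b * b)))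

lower-bound : ∀ {D p s c b} → ℤ.0ℤ ℤ.< D → (+ 5) ℤ.* ((+ b) ℤ.* (+ b)) ℤ.< D ℤ.* D →
  1 ≤ p → s * s ≤ 5 * (p * p) + 4 → s ≤ 3 * p → c ≤ 2 → 44 * (b * b) < p →
  + (s + 2 * c) ℤ.* + b ℤ.< D ℤ.* + p
lower-bound { + d} {p} {s} {c} {b} _ 5b²<D² 1≤p s² s≤3p c≤2 44b²<p =
  subst₂ ℤ._<_ (ℤ.pos-* (s + 2 * c) b) (ℤ.pos-* d p)
    (ℤ.+<+ (lower-ℕ {p} {s} {c} {b} {d} 1≤p s² s≤3p c≤2
      (ℤ.drop‿+<+ (subst₂ ℤ._<_ (pos-5* b) (sym (ℤ.pos-* d d)) 5b²<D²)) 44b²<p))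
lower-bound { -[1+ _ ]} ()

upper-bound : ∀ {D p s c b} → 1 ≤ b → D ℤ.≤ ℤ.0ℤ ⊎ D ℤ.* D ℤ.< (+ 5) ℤ.* ((+ b) ℤ.* (+ b)) →
  1 ≤ p → 5 * (p * p) ≤ s * s + 4 → 1 ≤ c → D ℤ.* + p ℤ.< + (s + 2 * c) ℤ.* + b
upper-bound {D} {p} {s} {c} {b} 1≤b D-small 1≤p s² 1≤c = go D D-small
  where
  positive : ℤ.0ℤ ℤ.< + (s + 2 * c) ℤ.* + b
  positive = subst (ℤ.0ℤ ℤ.<_) (ℤ.pos-* (s + 2 * c) b)
    (ℤ.+<+ (*-mono-≤ (≤-trans 1≤c (≤-trans (m≤n*m c 2) (m≤n+m (2 * c) s))) 1≤b))
  nonpositive : ∀ {D} → D ℤ.≤ ℤ.0ℤ → D ℤ.* + p ℤ.< + (s + 2 * c) ℤ.* + b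
  nonpositive {D} D≤0 = ℤ.≤-<-trans (ℤ.*-monoʳ-≤-nonNeg (+ p) {D} {ℤ.0ℤ} D≤0) positive
  go : ∀ D → D ℤ.≤ ℤ.0ℤ ⊎ D ℤ.* D ℤ.< (+ 5) ℤ.* ((+ b) ℤ.* (+ b)) → D ℤ.* + p ℤ.< + (s + 2 * c) ℤ.* + b
  go D (inj₁ D≤0) = nonpositive D≤0
  go D@(-[1+ _ ]) (inj₂ _) = nonpositive {D} ℤ.-≤+
  go (+ d) (inj₂ D²<5b²) = subst₂ ℤ._<_ (ℤ.pos-* d p) (ℤ.pos-* (s + 2 * c) b)
    (ℤ.+<+ (upper-ℕ {p} {s} {c} {b} {d} 1≤p s² 1≤c
      (ℤ.drop‿+<+ (subst₂ ℤ._<_ (sym (ℤ.pos-* d d)) (pos-5* b) D²<5b²))))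

-- The limit 1 + 1/φ², for the golden ratio φ, is (5 - √5)/2. With D = 5b - 2a, the fraction a/b
-- lies below it iff D > 0 and D² > 5b², and above it iff D ≤ 0 or D² < 5b². Convergence is
-- expressed by comparison with all rationals on either side.
theorem7 : ((n : ℕ) → 5 ≤ n →
    Σ (List (ℕ × ℕ)) λ L →
    Unique L
    × (∀ i j → ((i , j) ∈ L) ⇔ MCS (fibWord n) i j)
    × ((n % 2 ≡ 1 → length L ≡ F n + F (n ∸ 2) ∸ 1)
    × (n % 2 ≡ 0 → length L ≡ F n + F (n ∸ 2) ∸ 2)))
    × ((n : ℕ) → 5 ≤ n → (L : List (ℕ × ℕ)) → Unique L
    → (∀ i j → ((i , j) ∈ L) ⇔ MCS (fibWord n) i j)
    → length L < F n + F (n ∸ 2))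
    × ((a : ℤ) (b : ℕ) → 1 ≤ b
    → ℤ.0ℤ ℤ.< ((+ 5) ℤ.* (+ b) ℤ.- (+ 2) ℤ.* a)
    → (+ 5) ℤ.* ((+ b) ℤ.* (+ b)) ℤ.< ((+ 5) ℤ.* (+ b) ℤ.- (+ 2) ℤ.* a) ℤ.* ((+ 5) ℤ.* (+ b) ℤ.- (+ 2) ℤ.* a)
    → ∃ λ N → (n : ℕ) → N ≤ n → (L : List (ℕ × ℕ)) → Unique L
    → (∀ i j → ((i , j) ∈ L) ⇔ MCS (fibWord n) i j)
    → a ℤ.* (+ F n) ℤ.< (+ length L) ℤ.* (+ b))
    × ((a : ℤ) (b : ℕ) → 1 ≤ b
    → (((+ 5) ℤ.* (+ b) ℤ.- (+ 2) ℤ.* a) ℤ.≤ ℤ.0ℤ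
    ⊎ ((+ 5) ℤ.* (+ b) ℤ.- (+ 2) ℤ.* a) ℤ.* ((+ 5) ℤ.* (+ b) ℤ.- (+ 2) ℤ.* a) ℤ.< (+ 5) ℤ.* ((+ b) ℤ.* (+ b)))
    → ∃ λ N → (n : ℕ) → N ≤ n → (L : List (ℕ × ℕ)) → Unique L
    → (∀ i j → ((i , j) ∈ L) ⇔ MCS (fibWord n) i j)
    → (+ length L) ℤ.* (+ b) ℤ.< a ℤ.* (+ F n))
theorem7 = exact , bounded , from-below , from-above
  where
  exact : (n : ℕ) → 5 ≤ n → Σ (List (ℕ × ℕ)) λ L → Unique L
    × (∀ i j → ((i , j) ∈ L) ⇔ MCS (fibWord n) i j)
    × ((n % 2 ≡ 1 → length L ≡ F n + F (n ∸ 2) ∸ 1)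
    × (n % 2 ≡ 0 → length L ≡ F n + F (n ∸ 2) ∸ 2))
  exact n 5≤n with MCS-count n 5≤n
  ... | counted (inj₁ (odd , refl)) (L , u , refl , mem) e =
    L , u , (λ i j → mem (i , j)) , (λ _ → cong (_∸ 1) e) , λ even → contradiction (trans (sym even) odd) λ ()
  ... | counted (inj₂ (even , refl)) (L , u , refl , mem) e =
    L , u , (λ i j → mem (i , j)) , (λ odd → contradiction (trans (sym even) odd) λ ()) , λ _ → cong (_∸ 2) e

  bounded : _
  bounded n 5≤n L u mem with c , (1≤c , _) , e ← length-count n 5≤n L u mem =
    subst (length L <_) e (+-monoˡ-≤ (length L) 1≤c)

  from-below : _
  -- Since n ≤ F n, this threshold yields 44b² < F n as `lower-ℕ` demands, and it also contains 5 ≤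
  -- n.
  from-below a b 1≤b 0<D 5b²<D² = 6 + 44 * (b * b) , bound
    where
    bound : ∀ n → 6 + 44 * (b * b) ≤ n → (L : List (ℕ × ℕ)) → Unique L →
            (∀ i j → ((i , j) ∈ L) ⇔ MCS (fibWord n) i j) → a ℤ.* (+ F n) ℤ.< (+ length L) ℤ.* (+ b)
    bound (suc zero) (s≤s ())
    bound (suc (suc n)) N≤n L u mem =
      let c , (_ , c≤2) , e = length-count (2 + n) (≤-trans (m≤m+n 5 _) (≤-trans (n≤1+n _) N≤n)) L u mem in
      lower-ℤ a b {F (2 + n)} {length L} {S n + 2 * c} (5F≡ n {c} {length L} e)
        (lower-bound {s = S n} {c} {b} 0<D 5b²<D² (F-positive (2 + n)) (S²-upper n) (S≤3F n)
          c≤2 (≤-trans (m≤n+m _ 5) (≤-trans N≤n (n≤F (2 + n)))))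

  from-above : _
  from-above a b 1≤b D-small = 5 , bound
    where
    bound : ∀ n → 5 ≤ n → (L : List (ℕ × ℕ)) → Unique L →
            (∀ i j → ((i , j) ∈ L) ⇔ MCS (fibWord n) i j) → (+ length L) ℤ.* (+ b) ℤ.< a ℤ.* (+ F n)
    bound (suc zero) (s≤s ())
    bound (suc (suc n)) 5≤n L u mem =
      let c , (1≤c , _) , e = length-count (2 + n) 5≤n L u mem in
      upper-ℤ a b {F (2 + n)} {length L} {S n + 2 * c} (5F≡ n {c} {length L} e)
        (upper-bound {s = S n} {c} {b} 1≤b D-small (F-positive (2 + n)) (S²-lower n) 1≤c)
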